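{- Let $s,t\ge 1$ and $h\ge 3$ be fixed integers. Let $\mathcal{F}$ be a family of subsets of $[n]$ that contains no $h+s+t-2$ different sets $A_1,\dots,A_s,B_1,\dots,B_{h-2},C_1,\dots,C_t$ such that $A_1,A_2,\dots,A_s\subset B_1\subset B_2\subset\dots\subset B_{h-2}\subset C_1,C_2,\dots,C_t$ (each $A_i$ is contained in $B_1$, and $B_{h-2}$ is contained in each $C_j$), $|A_1|=|A_2|=\dots=|A_s|$ and $|C_1|=|C_2|=\dots=|C_t|$. Then $$|\mathcal{F}|\le \Sigma(n,h-1)+\binom{n}{\lfloor\frac{n+h}{2}\rfloor}\left(\frac{2(s+t-2)}{n}+O\left(\frac{\sqrt{\log n}}{n^{3/2}}\right)\right),$$ where the implied constant in the $O(\cdot)$ term does not depend on $n$.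
   Context: $[n]=\{1,2,\dots,n\}$. For integers $n,k$, $\Sigma(n,k)=\sum_{i=\lceil\frac{n-k}{2}\rceil}^{\lceil\frac{n+k}{2}\rceil-1}\binom{n}{i}$ denotes the sum of the $k$ largest binomial coefficients $\binom{n}{i}$. -}

module Defs where

open import Data.Nat using (ℕ; _+_; _*_; _∸_; _/_)
open import Data.Nat.Combinatorics using (_C_)
open import Data.List using (List; map; upTo)
open import Data.Nat.ListAction using (sum)
open import Data.List.Membership.Propositional using (_∈_)
import Data.Fin
import Data.Nat
open import Data.Fin using (Fin)
open import Data.Fin.Subset using (Subset; _⊆_; _⊂_; ∣_∣)
open import Relation.Binary.PropositionalEquality using (_≡_; _≢_)
open import Data.Product using (_×_)

⌈_/2⌉ : ℕ → ℕ
⌈ m /2⌉ = (m + 1) / 2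

-- Σ(n,k) = ∑_{i = ⌈(n-k)/2⌉}^{⌈(n+k)/2⌉ - 1} (n choose i).
-- For n < k the true lower limit ⌈(n-k)/2⌉ is ≤ 0; the terms with negative i
-- are 0, so starting at 0 (truncated subtraction) gives the same sum.
-- Terms with i > n are 0 since n C i = 0 there.
Σbin : ℕ → ℕ → ℕ
Σbin n k = sum (map (λ j → n C (lo + j)) (upTo (hi ∸ lo)))
  where
    lo = ⌈ n ∸ k /2⌉
    hi = ⌈ n + k /2⌉

-- The forbidden configuration in a family F of subsets of [n]:
-- h+s+t-2 pairwise different sets A_1..A_s, B_1..B_{h-2}, C_1..C_t in F with
-- every A_i ⊆ B_1 ⊂ B_2 ⊂ ... ⊂ B_{h-2} ⊆ every C_j,
-- |A_1| = ... = |A_s| and |C_1| = ... = |C_t|.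
-- (The containments A_i ⊆ B_k, B_k ⊆ C_j for all k follow from / are the
-- content of the chain; we state them for all k.)
record Config (n s t h : ℕ) (F : List (Subset n)) : Set where
  field
    A : Fin s → Subset n
    B : Fin (h ∸ 2) → Subset n
    C : Fin t → Subset n
    A∈F : ∀ i → A i ∈ F
    B∈F : ∀ k → B k ∈ F
    C∈F : ∀ j → C j ∈ F
    A-inj : ∀ i i′ → A i ≡ A i′ → i ≡ i′
    B-inj : ∀ k k′ → B k ≡ B k′ → k ≡ k′
    C-inj : ∀ j j′ → C j ≡ C j′ → j ≡ j′
    A≢B : ∀ i k → A i ≢ B k
    A≢C : ∀ i j → A i ≢ C j
    B≢C : ∀ k j → B k ≢ C j
    A⊆B : ∀ i k → A i ⊆ B k
    B-chain : ∀ k k′ → Data.Fin.toℕ k Data.Nat.< Data.Fin.toℕ k′ → B k ⊂ B k′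
    B⊆C : ∀ k j → B k ⊆ C j
    A-size : ∀ i i′ → ∣ A i ∣ ≡ ∣ A i′ ∣
    C-size : ∀ j j′ → ∣ C j ∣ ≡ ∣ C j′ ∣

{-# OPTIONS --safe #-}
module Submission where

-- Restrict F to the sets of size between lo and n ∸ lo, where n/2 − lo is of order √(n log n); the
-- binomial coefficients outside this window are at most n⁻³ times the middle ones.
-- Call D ∈ F down-light if each level contains at most s − 1 members of F strictly below D, and up-light
-- if each level contains at most t − 1 members of F strictly above D.  A chain of h − 2 members that are
-- neither down-light nor up-light yields a forbidden configuration, so on average a random maximal chain
-- meets at most h − 3 of them.  The number X of down-light members on a maximal chain satisfies
-- X ≤ 1 + (X choose 2), and a down-light D has on average at most (s − 1)(2/n + O(√(log n) / n^{3/2}))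
-- members of F below it on a chain through D, because only the level just below D contributes to first
-- order.  Hence E[X] ≤ 1 + 2(s − 1)/n + O(√(log n) / n^{3/2}), and dually for up-light members.  Altogether
-- ∑ 1 / (n choose |D|) ≤ h − 1 + 2(s + t − 2)/n + O(√(log n) / n^{3/2}), which bounds |F| because the
-- first h − 1 units of this sum are spent most efficiently on the h − 1 largest levels, and the rest costs
-- at least the inverse of the h-th largest binomial coefficient per set.

open import Defs
open import Data.Bool using () renaming (_≟_ to _≟ᵇ_)
open import Data.Fin using (Fin; zero; suc; toℕ; fromℕ; inject≤)
open import Data.Fin.Properties using (≤fromℕ; toℕ-injective; inject≤-injective)
open import Data.Fin.Subset using (Subset; inside; outside; _⊆_; _⊂_; ∣_∣; ⊤)
open import Data.Fin.Subset.Properties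
open import Data.List using (List; []; _∷_; length; map; filter; upTo; applyUpTo; lookup)
open import Data.List.Membership.Propositional using (_∈_; find; lose)
open import Data.List.Membership.Propositional.Properties
  using (∈-filter⁻; ∈-filter⁺; ∈-lookup; ∈-map⁺; ∈-map⁻; ∈-upTo⁺; ∈-upTo⁻; ∈-applyUpTo⁺; ∈-applyUpTo⁻)
open import Data.List.Properties using (length-map; length-filter; length-upTo; length-applyUpTo)
open import Data.List.Relation.Unary.All as All using (All; []; _∷_)
open import Data.List.Relation.Unary.AllPairs using ([]; _∷_)
open import Data.List.Relation.Unary.Any using (Any; here; there; any?)
open import Data.List.Relation.Unary.Unique.Propositional using (Unique)
import Data.List.Relation.Unary.Unique.Propositional.Properties as Unique
open import Data.Nat hiding (⌈_/2⌉)
import Data.Nat as ℕ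
open import Data.Nat.Combinatorics using (_C_; nCk≡n!/k![n-k]!; k![n∸k]!∣n!)
open import Data.Nat.Divisibility using (divides-refl)
open import Data.Nat.DivMod using (m/n*n≡m; m*n/n≡m; +-distrib-/-∣ʳ; m/n*n≤m; m≡m%n+[m/n]*n; m%n<n)
open import Data.Nat.Induction using (<-rec)
open import Data.Nat.ListAction using (sum)
open import Data.Nat.Logarithm using (⌊log₂_⌋; ⌊log₂⌋-mono-≤; ⌊log₂⌊n/2⌋⌋≡⌊log₂n⌋∸1; ⌊log₂[2^n]⌋≡n)
open import Data.Nat.Properties
open import Data.Nat.Tactic.RingSolver using (solve-∀)
open import Data.Product using (∃; _×_; _,_; proj₁; proj₂)
open import Data.Sum using (_⊎_; inj₁; inj₂)
open import Data.Vec using ([]; _∷_; here; there)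
open import Data.Vec.Properties using (≡-dec)
open import Function using (_∘_)
open import Level using (Level)
open import Relation.Binary.Definitions using (tri<; tri≈; tri>)
open import Relation.Binary.PropositionalEquality using (_≡_; _≢_; refl; sym; trans; cong; cong₂; subst)
open import Relation.Nullary
open import Relation.Nullary.Decidable using (_×-dec_; _⊎-dec_)
open import Relation.Unary using (Pred; Decidable)
import Relation.Unary.Properties as U
open import Algebra.Properties.CommutativeSemigroup *-commutativeSemigroup using () renaming (x∙yz≈y∙xz to *-swap; interchange to *-interchange)
open import Algebra.Properties.CommutativeSemigroup +-commutativeSemigroup using () renaming (x∙yz≈y∙xz to +-swap; interchange to +-interchange)

private variable
  ℓ ℓ′ : Level
  X Y : Set
  P : Set ℓ
  n : ℕ
  A B D : Subset n

-- Sums over lists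

∑ : List X → (X → ℕ) → ℕ
∑ xs f = sum (map f xs)

𝟙 : Dec P → ℕ
𝟙 (yes _) = 1
𝟙 (no _)  = 0

𝟙-yes : (P? : Dec P) → P → 𝟙 P? ≡ 1
𝟙-yes (yes _) _ = refl
𝟙-yes (no ¬p) p = contradiction p ¬p

𝟙-no : (P? : Dec P) → ¬ P → 𝟙 P? ≡ 0
𝟙-no (yes p) ¬p = contradiction p ¬p
𝟙-no (no _)  _  = refl

𝟙-⇔ : {Q : Set ℓ′} (P? : Dec P) (Q? : Dec Q) → (P → Q) → (Q → P) → 𝟙 P? ≡ 𝟙 Q?
𝟙-⇔ (yes p) Q? f g = sym (𝟙-yes Q? (f p))
𝟙-⇔ (no ¬p) Q? f g = sym (𝟙-no Q? (¬p ∘ g))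

∑-mono : (xs : List X) {f g : X → ℕ} → (∀ {x} → x ∈ xs → f x ≤ g x) → ∑ xs f ≤ ∑ xs g
∑-mono []       f≤g = z≤n
∑-mono (x ∷ xs) f≤g = +-mono-≤ (f≤g (here refl)) (∑-mono xs (f≤g ∘ there))

∑-cong : (xs : List X) {f g : X → ℕ} → (∀ {x} → x ∈ xs → f x ≡ g x) → ∑ xs f ≡ ∑ xs g
∑-cong []       f≡g = refl
∑-cong (x ∷ xs) f≡g = cong₂ _+_ (f≡g (here refl)) (∑-cong xs (f≡g ∘ there))

∑-+ : (xs : List X) (f g : X → ℕ) → ∑ xs (λ x → f x + g x) ≡ ∑ xs f + ∑ xs g
∑-+ []       f g = refl
∑-+ (x ∷ xs) f g rewrite ∑-+ xs f g = +-interchange (f x) (g x) (∑ xs f) (∑ xs g)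

∑-*ˡ : (xs : List X) (c : ℕ) (f : X → ℕ) → ∑ xs (λ x → c * f x) ≡ c * ∑ xs f
∑-*ˡ []       c f = sym (*-zeroʳ c)
∑-*ˡ (x ∷ xs) c f rewrite ∑-*ˡ xs c f = sym (*-distribˡ-+ c (f x) (∑ xs f))

∑-*ʳ : (xs : List X) (c : ℕ) (f : X → ℕ) → ∑ xs (λ x → f x * c) ≡ ∑ xs f * c
∑-*ʳ []       c f = refl
∑-*ʳ (x ∷ xs) c f rewrite ∑-*ʳ xs c f = sym (*-distribʳ-+ c (f x) (∑ xs f))

∑-const : (xs : List X) (c : ℕ) → ∑ xs (λ _ → c) ≡ length xs * c
∑-const []       c = refl
∑-const (x ∷ xs) c = cong (c +_) (∑-const xs c)

∑-comm : (xs : List X) (ys : List Y) (f : X → Y → ℕ) →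
         ∑ xs (λ x → ∑ ys (f x)) ≡ ∑ ys (λ y → ∑ xs (λ x → f x y))
∑-comm []       ys f = sym (trans (∑-const ys 0) (*-zeroʳ (length ys)))
∑-comm (x ∷ xs) ys f rewrite ∑-comm xs ys f = sym (∑-+ ys (f x) (λ y → ∑ xs (λ x → f x y)))

∑-filter : {P : Pred X ℓ} (P? : Decidable P) (xs : List X) (f : X → ℕ) →
           ∑ (filter P? xs) f ≡ ∑ xs (λ x → 𝟙 (P? x) * f x)
∑-filter P? []       f = refl
∑-filter P? (x ∷ xs) f with P? x
... | yes _ = cong₂ _+_ (sym (+-identityʳ (f x))) (∑-filter P? xs f)
... | no  _ = ∑-filter P? xs f

length-filter-∑ : {P : Pred X ℓ} (P? : Decidable P) (xs : List X) →
                  length (filter P? xs) ≡ ∑ xs (λ x → 𝟙 (P? x))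
length-filter-∑ P? xs = trans (sym (trans (∑-const (filter P? xs) 1) (*-identityʳ _)))
  (trans (∑-filter P? xs (λ _ → 1)) (∑-cong xs (λ _ → *-identityʳ _)))

∑-split : {P : Pred X ℓ} (P? : Decidable P) (xs : List X) (f : X → ℕ) →
          ∑ xs f ≡ ∑ (filter P? xs) f + ∑ (filter (U.∁? P?) xs) f
∑-split P? []       f = refl
∑-split P? (x ∷ xs) f with P? x
... | yes _ = trans (cong (f x +_) (∑-split P? xs f)) (sym (+-assoc (f x) _ _))
... | no  _ = trans (cong (f x +_) (∑-split P? xs f)) (+-swap (f x) (∑ (filter P? xs) f) _)

∑-filter-≤ : {P : Pred X ℓ} (P? : Decidable P) (xs : List X) (f : X → ℕ) → ∑ (filter P? xs) f ≤ ∑ xs f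
∑-filter-≤ P? xs f = ≤-trans (m≤m+n _ _) (≤-reflexive (sym (∑-split P? xs f)))

length-split : {P : Pred X ℓ} (P? : Decidable P) (xs : List X) →
               length xs ≡ length (filter P? xs) + length (filter (U.∁? P?) xs)
length-split P? []       = refl
length-split P? (x ∷ xs) with P? x
... | yes _ = cong suc (length-split P? xs)
... | no  _ = trans (cong suc (length-split P? xs)) (sym (+-suc _ _))

∑-∈-≤ : {xs : List X} {x : X} (f : X → ℕ) → x ∈ xs → f x ≤ ∑ xs f
∑-∈-≤ f (here refl)                = m≤m+n _ _
∑-∈-≤ {xs = y ∷ xs} f (there x∈xs) = ≤-trans (∑-∈-≤ f x∈xs) (m≤n+m _ (f y))

∑-δ-∉ : (_≟_ : (x y : X) → Dec (x ≡ y)) (xs : List X) {a : X} (f : X → ℕ) →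
        All (a ≢_) xs → ∑ xs (λ x → 𝟙 (a ≟ x) * f x) ≡ 0
∑-δ-∉ _≟_ []       f []           = refl
∑-δ-∉ _≟_ (x ∷ xs) {a} f (a≢x ∷ a∉) rewrite 𝟙-no (a ≟ x) a≢x = ∑-δ-∉ _≟_ xs f a∉

∑-δ : (_≟_ : (x y : X) → Dec (x ≡ y)) {xs : List X} {a : X} (f : X → ℕ) →
      Unique xs → a ∈ xs → ∑ xs (λ x → 𝟙 (a ≟ x) * f x) ≡ f a
∑-δ _≟_ {a ∷ xs} f (a∉ ∷ _) (here refl) rewrite 𝟙-yes (a ≟ a) refl | ∑-δ-∉ _≟_ xs f a∉ =
  trans (+-identityʳ _) (+-identityʳ _)
∑-δ _≟_ {x ∷ xs} {a} f (x∉ ∷ u) (there a∈)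
  rewrite 𝟙-no (a ≟ x) (λ { refl → All.lookup x∉ a∈ refl }) = ∑-δ _≟_ f u a∈

level : (X → ℕ) → ℕ → List X → List X
level f i = filter (λ x → f x ≟ i)

-- Only an inequality, because `ls` may list a value twice and then counts its level twice.
∑-by-levels : (f φ : X → ℕ) (ls : List ℕ) (xs : List X) → (∀ {x} → x ∈ xs → f x ∈ ls) →
              ∑ xs φ ≤ ∑ ls (λ i → ∑ (level f i xs) φ)
∑-by-levels f φ ls xs f∈ = begin
  ∑ xs φ                                       ≤⟨ ∑-mono xs one ⟩
  ∑ xs (λ x → ∑ ls (λ i → 𝟙 (f x ≟ i) * φ x))  ≡⟨ ∑-comm xs ls _ ⟩
  ∑ ls (λ i → ∑ xs (λ x → 𝟙 (f x ≟ i) * φ x))  ≡⟨ ∑-cong ls (λ {i} _ → sym (∑-filter (λ x → f x ≟ i) xs φ)) ⟩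
  ∑ ls (λ i → ∑ (level f i xs) φ)              ∎
  where
  open ≤-Reasoning
  one : ∀ {x} → x ∈ xs → φ x ≤ ∑ ls (λ i → 𝟙 (f x ≟ i) * φ x)
  one {x} x∈ = begin
    φ x                              ≡⟨ sym (*-identityˡ (φ x)) ⟩
    1 * φ x                          ≡⟨ cong (_* φ x) (sym (𝟙-yes (f x ≟ f x) refl)) ⟩
    𝟙 (f x ≟ f x) * φ x              ≤⟨ ∑-∈-≤ (λ i → 𝟙 (f x ≟ i) * φ x) (f∈ x∈) ⟩
    ∑ ls (λ i → 𝟙 (f x ≟ i) * φ x)   ∎

length-by-levels : (f : X → ℕ) (ls : List ℕ) (xs : List X) → (∀ {x} → x ∈ xs → f x ∈ ls) →
                   length xs ≤ ∑ ls (λ i → length (level f i xs))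
length-by-levels f ls xs f∈ = begin
  length xs                                  ≡⟨ len xs ⟨
  ∑ xs (λ _ → 1)                             ≤⟨ ∑-by-levels f (λ _ → 1) ls xs f∈ ⟩
  ∑ ls (λ i → ∑ (level f i xs) (λ _ → 1))    ≡⟨ ∑-cong ls (λ {i} _ → len (level f i xs)) ⟩
  ∑ ls (λ i → length (level f i xs))         ∎
  where
  open ≤-Reasoning
  len : (ys : List _) → ∑ ys (λ _ → 1) ≡ length ys
  len ys = trans (∑-const ys 1) (*-identityʳ _)

-- Counting maximal chains

_≟ˢ_ : (A B : Subset n) → Dec (A ≡ B)
_≟ˢ_ = ≡-dec _≟ᵇ_

⊆∧≢⇒⊂ : D ⊆ A → D ≢ A → D ⊂ A
⊆∧≢⇒⊂ {D = []} {A = []} D⊆A D≢A = contradiction refl D≢A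
⊆∧≢⇒⊂ {D = outside ∷ D} {A = inside  ∷ A} D⊆A D≢A = out⊂in (drop-∷-⊆ D⊆A)
⊆∧≢⇒⊂ {D = inside  ∷ D} {A = outside ∷ A} D⊆A D≢A = contradiction (D⊆A here) λ ()
⊆∧≢⇒⊂ {D = outside ∷ D} {A = outside ∷ A} D⊆A D≢A = s⊂s (⊆∧≢⇒⊂ (drop-∷-⊆ D⊆A) (D≢A ∘ cong (outside ∷_)))
⊆∧≢⇒⊂ {D = inside  ∷ D} {A = inside  ∷ A} D⊆A D≢A = s⊂s (⊆∧≢⇒⊂ (drop-∷-⊆ D⊆A) (D≢A ∘ cong (inside ∷_)))

-- The sets covered by `A` in the subset lattice, that is, `A` with one element removed.
covers : Subset n → List (Subset n)
covers []            = []
covers (inside  ∷ A) = (outside ∷ A) ∷ map (inside ∷_) (covers A)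
covers (outside ∷ A) = map (outside ∷_) (covers A)

length-covers : (A : Subset n) → length (covers A) ≡ ∣ A ∣
length-covers []            = refl
length-covers (inside  ∷ A) = cong suc (trans (length-map _ (covers A)) (length-covers A))
length-covers (outside ∷ A) = trans (length-map _ (covers A)) (length-covers A)

cover-size : (A : Subset n) → B ∈ covers A → suc ∣ B ∣ ≡ ∣ A ∣
cover-size (inside ∷ A) (here refl) = refl
cover-size (inside ∷ A) (there B∈) with ∈-map⁻ _ B∈
... | _ , B′∈ , refl = cong suc (cover-size A B′∈)
cover-size (outside ∷ A) B∈ with ∈-map⁻ _ B∈
... | _ , B′∈ , refl = cover-size A B′∈

cover-⊂ : (A : Subset n) → B ∈ covers A → B ⊂ A
cover-⊂ (inside ∷ A) (here refl) = out⊂in ⊆-refl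
cover-⊂ (inside ∷ A) (there B∈) with ∈-map⁻ _ B∈
... | _ , B′∈ , refl = s⊂s (cover-⊂ A B′∈)
cover-⊂ (outside ∷ A) B∈ with ∈-map⁻ _ B∈
... | _ , B′∈ , refl = s⊂s (cover-⊂ A B′∈)

∑-map : {X Y : Set} (g : X → Y) (xs : List X) (f : Y → ℕ) → ∑ (map g xs) f ≡ ∑ xs (f ∘ g)
∑-map g []       f = refl
∑-map g (x ∷ xs) f = cong (f (g x) +_) (∑-map g xs f)

-- A set covered by `A` contains `D` exactly when the removed element lies in `A` but not in `D`.
-- The additive form avoids truncated subtraction.
covers-above : D ⊆ A → ∑ (covers A) (λ B → 𝟙 (D ⊆? B)) + ∣ D ∣ ≡ ∣ A ∣
covers-above {D = []} {A = []} D⊆A = refl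
covers-above {D = inside ∷ D} {A = outside ∷ A} D⊆A = contradiction (D⊆A here) λ ()
covers-above {D = inside ∷ D} {A = inside ∷ A} D⊆A
  rewrite ∑-map (inside ∷_) (covers A) (λ B → 𝟙 ((inside ∷ D) ⊆? B))
        | ∑-cong (covers A) {λ B → 𝟙 ((inside ∷ D) ⊆? (inside ∷ B))} {λ B → 𝟙 (D ⊆? B)}
            (λ {B} _ → 𝟙-⇔ ((inside ∷ D) ⊆? (inside ∷ B)) (D ⊆? B) drop-∷-⊆ s⊆s)
  = trans (+-suc _ _) (cong suc (covers-above (drop-∷-⊆ D⊆A)))
covers-above {D = outside ∷ D} {A = inside ∷ A} D⊆A
  rewrite 𝟙-yes ((outside ∷ D) ⊆? (outside ∷ A)) (s⊆s (drop-∷-⊆ D⊆A))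
        | ∑-map (inside ∷_) (covers A) (λ B → 𝟙 ((outside ∷ D) ⊆? B))
        | ∑-cong (covers A) {λ B → 𝟙 ((outside ∷ D) ⊆? (inside ∷ B))} {λ B → 𝟙 (D ⊆? B)}
            (λ {B} _ → 𝟙-⇔ ((outside ∷ D) ⊆? (inside ∷ B)) (D ⊆? B) drop-∷-⊆ out⊆)
  = cong suc (covers-above (drop-∷-⊆ D⊆A))
covers-above {D = outside ∷ D} {A = outside ∷ A} D⊆A
  rewrite ∑-map (outside ∷_) (covers A) (λ B → 𝟙 ((outside ∷ D) ⊆? B))
        | ∑-cong (covers A) {λ B → 𝟙 ((outside ∷ D) ⊆? (outside ∷ B))} {λ B → 𝟙 (D ⊆? B)}
            (λ {B} _ → 𝟙-⇔ ((outside ∷ D) ⊆? (outside ∷ B)) (D ⊆? B) drop-∷-⊆ out⊆)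
  = covers-above (drop-∷-⊆ D⊆A)

-- The factorial of the size difference counts the maximal chains from `D` to `A`. If `g D` counts
-- the ways to reach `D` from the empty set, each term counts the maximal chains to `A` through `D`.
weightBelow weightStrictlyBelow : List (Subset n) → (Subset n → ℕ) → Subset n → ℕ
weightBelow         F g A = ∑ F (λ D → 𝟙 (D ⊆? A) * (g D * (∣ A ∣ ∸ ∣ D ∣) !))
weightStrictlyBelow F g A = ∑ F (λ D → 𝟙 (D ⊂? A) * (g D * (∣ A ∣ ∸ ∣ D ∣) !))

-- A maximal chain from D to A ⊃ D passes through exactly one of the sets covered by A.
weightStrictlyBelow-covers : (F : List (Subset n)) (g : Subset n → ℕ) (A : Subset n) →
                             weightStrictlyBelow F g A ≡ ∑ (covers A) (weightBelow F g)
weightStrictlyBelow-covers F g A = sym (trans (∑-comm (covers A) F _) (∑-cong F (λ {D} _ → pointwise D)))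
  where
  open ≤-Reasoning
  pointwise : ∀ D → ∑ (covers A) (λ B → 𝟙 (D ⊆? B) * (g D * (∣ B ∣ ∸ ∣ D ∣) !)) ≡
                    𝟙 (D ⊂? A) * (g D * (∣ A ∣ ∸ ∣ D ∣) !)
  pointwise D with D ⊂? A
  ... | no  D⊄A = trans
    (∑-cong (covers A) (λ {B} B∈ → cong (_* (g D * (∣ B ∣ ∸ ∣ D ∣) !))
       (𝟙-no (D ⊆? B) (λ D⊆B → D⊄A (⊆-⊂-trans D⊆B (cover-⊂ A B∈))))))
    (trans (∑-const (covers A) 0) (*-zeroʳ (length (covers A))))
  -- There are `suc k` sets covered by `A` above `D`, and each is reached from `D` by `k !` chains;
  -- together these are the `(suc k) !` chains from `D` to `A`.
  ... | yes D⊂A with m≤n⇒∃[o]m+o≡n (p⊂q⇒∣p∣<∣q∣ D⊂A)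
  ...   | k , sd+k≡a = begin-equality
    ∑ (covers A) (λ B → 𝟙 (D ⊆? B) * (g D * (∣ B ∣ ∸ ∣ D ∣) !))
      ≡⟨ ∑-cong (covers A) (λ {B} B∈ → cong (λ m → 𝟙 (D ⊆? B) * (g D * m !)) (size B∈)) ⟩
    ∑ (covers A) (λ B → 𝟙 (D ⊆? B) * (g D * k !))
      ≡⟨ ∑-*ʳ (covers A) (g D * k !) _ ⟩
    ∑ (covers A) (λ B → 𝟙 (D ⊆? B)) * (g D * k !)
      ≡⟨ cong (_* (g D * k !)) (+-cancelʳ-≡ ∣ D ∣ _ (suc k) (trans (covers-above (proj₁ D⊂A)) a≡)) ⟩
    suc k * (g D * k !)
      ≡⟨ *-swap (suc k) (g D) (k !) ⟩
    g D * (suc k) !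
      ≡⟨ cong (λ m → g D * m !) (sym (trans (cong (_∸ ∣ D ∣) a≡) (m+n∸n≡m (suc k) ∣ D ∣))) ⟩
    g D * (∣ A ∣ ∸ ∣ D ∣) !
      ≡⟨ sym (+-identityʳ _) ⟩
    1 * (g D * (∣ A ∣ ∸ ∣ D ∣) !) ∎
    where
    a≡ : ∣ A ∣ ≡ suc k + ∣ D ∣
    a≡ = trans (sym sd+k≡a) (cong suc (+-comm ∣ D ∣ k))
    size : ∀ {B} → B ∈ covers A → ∣ B ∣ ∸ ∣ D ∣ ≡ k
    size B∈ = trans (cong (_∸ ∣ D ∣) (suc-injective (trans (cover-size A B∈) a≡))) (m+n∸n≡m k ∣ D ∣)

weightBelow-split : (F : List (Subset n)) (g : Subset n → ℕ) (A : Subset n) →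
  weightBelow F g A ≡ ∑ F (λ D → 𝟙 (A ≟ˢ D) * g D) + weightStrictlyBelow F g A
weightBelow-split F g A = trans (∑-cong F (λ {D} _ → pointwise D)) (∑-+ F _ _)
  where
  pointwise : ∀ D → 𝟙 (D ⊆? A) * (g D * (∣ A ∣ ∸ ∣ D ∣) !) ≡
                    𝟙 (A ≟ˢ D) * g D + 𝟙 (D ⊂? A) * (g D * (∣ A ∣ ∸ ∣ D ∣) !)
  pointwise D with A ≟ˢ D
  ... | yes refl rewrite 𝟙-yes (A ⊆? A) ⊆-refl | 𝟙-no (A ⊂? A) (⊂-irref refl) | n∸n≡0 ∣ A ∣
                       | *-identityʳ (g A) = sym (+-identityʳ _)
  ... | no A≢D = cong (_* (g D * (∣ A ∣ ∸ ∣ D ∣) !))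
    (𝟙-⇔ (D ⊆? A) (D ⊂? A) (λ D⊆A → ⊆∧≢⇒⊂ D⊆A (A≢D ∘ sym)) proj₁)

-- The number of maximal chains from the empty set to `D`.
chains : Subset n → ℕ
chains D = ∣ D ∣ !

module _ (F : List (Subset n)) (F! : Unique F) where

  -- Counts maximal chains from ∅ to A: X members of F on a chain satisfy X ≤ 1 + (X choose 2).
  weightBelow-≤-pairs : ∀ m A → ∣ A ∣ ≡ m →
    weightBelow F chains A ≤ m ! + weightBelow F (weightStrictlyBelow F chains) A
  weightBelow-≤-pairs m A |A|≡m with any? (A ≟ˢ_) F
  -- Here `A` lies on all `m !` chains, and the `W` incidences strictly below `A` are matched by the
  -- pairs whose upper member is `A`.
  ... | yes A∈F = begin
    weightBelow F chains A
      ≡⟨ weightBelow-split F chains A ⟩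
    ∑ F (λ D → 𝟙 (A ≟ˢ D) * chains D) + W
      ≡⟨ cong (_+ W) (∑-δ _≟ˢ_ chains F! A∈F) ⟩
    ∣ A ∣ ! + W
      ≡⟨ cong (λ a → a ! + W) |A|≡m ⟩
    m ! + W
      ≡⟨ cong (m ! +_) (∑-δ _≟ˢ_ (weightStrictlyBelow F chains) F! A∈F) ⟨
    m ! + ∑ F (λ D → 𝟙 (A ≟ˢ D) * weightStrictlyBelow F chains D)
      ≤⟨ +-monoʳ-≤ (m !) (m≤m+n _ _) ⟩
    m ! + (∑ F (λ D → 𝟙 (A ≟ˢ D) * weightStrictlyBelow F chains D) +
           weightStrictlyBelow F (weightStrictlyBelow F chains) A)
      ≡⟨ cong (m ! +_) (weightBelow-split F (weightStrictlyBelow F chains) A) ⟨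
    m ! + weightBelow F (weightStrictlyBelow F chains) A ∎
    where
    open ≤-Reasoning
    W = weightStrictlyBelow F chains A
  -- Here every incidence and every pair lies on the part of the chain up to a set covered by `A`,
  -- so the bounds for the `m` covered sets are added up.
  ... | no A∉F = begin
    weightBelow F chains A
      ≡⟨ all-strict chains ⟩
    ∑ (covers A) (weightBelow F chains)
      ≤⟨ step m |A|≡m ⟩
    m ! + ∑ (covers A) (weightBelow F pairs)
      ≡⟨ cong (m ! +_) (all-strict pairs) ⟨
    m ! + weightBelow F pairs A ∎
    where
    open ≤-Reasoning
    pairs = weightStrictlyBelow F chains
    A≢F : All (A ≢_) F
    A≢F = All.tabulate (λ { D∈ refl → A∉F D∈ })
    all-strict : ∀ g → weightBelow F g A ≡ ∑ (covers A) (weightBelow F g)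
    all-strict g = trans (weightBelow-split F g A)
      (trans (cong (_+ weightStrictlyBelow F g A) (∑-δ-∉ _≟ˢ_ F g A≢F)) (weightStrictlyBelow-covers F g A))
    step : ∀ m → ∣ A ∣ ≡ m →
           ∑ (covers A) (weightBelow F chains) ≤ m ! + ∑ (covers A) (weightBelow F pairs)
    step zero    |A|≡0 with covers A | trans (length-covers A) |A|≡0
    ... | [] | _ = z≤n
    step (suc m) |A|≡m = begin
      ∑ (covers A) (weightBelow F chains)
        ≤⟨ ∑-mono (covers A) (λ {B} B∈ → weightBelow-≤-pairs m B (suc-injective (trans (cover-size A B∈) |A|≡m))) ⟩
      ∑ (covers A) (λ B → m ! + weightBelow F pairs B)
        ≡⟨ ∑-+ (covers A) (λ _ → m !) (weightBelow F pairs) ⟩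
      ∑ (covers A) (λ _ → m !) + ∑ (covers A) (weightBelow F pairs)
        ≡⟨ cong (_+ ∑ (covers A) (weightBelow F pairs)) (trans (∑-const (covers A) (m !))
             (cong (_* m !) (trans (length-covers A) |A|≡m))) ⟩
      suc m ! + ∑ (covers A) (weightBelow F pairs) ∎

-- n ! times the Lubell function ∑ 1 / (n choose |D|).
lubell : List (Subset n) → ℕ
lubell {n} F = ∑ F (λ D → ∣ D ∣ ! * (n ∸ ∣ D ∣) !)

weightBelow-⊤ : (F : List (Subset n)) (g : Subset n → ℕ) →
                weightBelow F g ⊤ ≡ ∑ F (λ D → g D * (n ∸ ∣ D ∣) !)
weightBelow-⊤ {n} F g = ∑-cong F (λ {D} _ → begin-equality
  𝟙 (D ⊆? ⊤) * (g D * (∣ ⊤ {n} ∣ ∸ ∣ D ∣) !) ≡⟨ cong₂ _*_ (𝟙-yes (D ⊆? ⊤) ⊆⊤) (cong (λ m → g D * (m ∸ ∣ D ∣) !) (∣⊤∣≡n n)) ⟩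
  1 * (g D * (n ∸ ∣ D ∣) !)                  ≡⟨ *-identityˡ _ ⟩
  g D * (n ∸ ∣ D ∣) !                        ∎)
  where open ≤-Reasoning

-- This is E[X] ≤ 1 + E[(X choose 2)] for a random maximal chain, multiplied by `n !`: the count of
-- chains from the empty set, taken up to the full set.
lubell-≤-pairs : (F : List (Subset n)) → Unique F →
  lubell F ≤ n ! + ∑ F (λ D → weightStrictlyBelow F chains D * (n ∸ ∣ D ∣) !)
lubell-≤-pairs {n} F F! = begin
  lubell F                                                   ≡⟨ weightBelow-⊤ F chains ⟨
  weightBelow F chains ⊤                            ≤⟨ weightBelow-≤-pairs F F! n ⊤ (∣⊤∣≡n n) ⟩
  n ! + weightBelow F (weightStrictlyBelow F chains) ⊤ ≡⟨ cong (n ! +_) (weightBelow-⊤ F (weightStrictlyBelow F chains)) ⟩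
  n ! + ∑ F (λ D → weightStrictlyBelow F chains D * (n ∸ ∣ D ∣) !) ∎
  where open ≤-Reasoning

-- The LYM inequality: in an antichain the pair term of `lubell-≤-pairs` vanishes.
lubell-antichain : (F : List (Subset n)) → Unique F → (∀ {D E} → D ∈ F → E ∈ F → ¬ D ⊂ E) → lubell F ≤ n !
lubell-antichain {n} F F! anti = begin
  lubell F                                                             ≤⟨ lubell-≤-pairs F F! ⟩
  n ! + ∑ F (λ E → weightStrictlyBelow F chains E * (n ∸ ∣ E ∣) !)
    ≡⟨ cong (n ! +_) (zeros F (λ {E} E∈ → cong (_* _) (zeros F (λ {D} D∈ → cong (_* (chains D * (∣ E ∣ ∸ ∣ D ∣) !)) (𝟙-no (D ⊂? _) (anti D∈ E∈)))))) ⟩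
  n ! + 0                                                              ≡⟨ +-identityʳ (n !) ⟩
  n !                                                                  ∎
  where
  open ≤-Reasoning
  zeros : (xs : List (Subset n)) {f : Subset n → ℕ} → (∀ {x} → x ∈ xs → f x ≡ 0) → ∑ xs f ≡ 0
  zeros xs f≡0 = trans (∑-cong xs f≡0) (trans (∑-const xs 0) (*-zeroʳ (length xs)))

-- Chains inside a family

data Chain (F : List (Subset n)) : ℕ → Subset n → Set where
  [_] : B ∈ F → Chain F 1 B
  step : ∀ {m} → A ∈ F → A ⊂ B → Chain F m B → Chain F (suc m) A

bottom∈ : ∀ {F : List (Subset n)} {m} → Chain F m A → A ∈ F
bottom∈ [ A∈ ]        = A∈
bottom∈ (step A∈ _ _) = A∈

nonMinimal? : (F : List (Subset n)) → Decidable (λ A → Any (_⊂ A) F)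
nonMinimal? F A = any? (_⊂? A) F

-- The minimal members form an antichain and contribute at most `n !`. A chain of non-minimal
-- members can be prolonged downwards by a member below its lowest set, so induction on `k` applies
-- to the non-minimal members.
lubell-chain : ∀ k (F : List (Subset n)) → Unique F → lubell F ≤ k * n ! ⊎ ∃ (Chain F (suc k))
lubell-chain zero    []      F! = inj₁ z≤n
lubell-chain zero    (A ∷ F) F! = inj₂ (A , [ here refl ])
lubell-chain {n} (suc k) F F!
  with lubell-chain k (filter (nonMinimal? F) F) (Unique.filter⁺ (nonMinimal? F) F!)
... | inj₁ le = inj₁ (begin
  lubell F                                        ≡⟨ ∑-split (nonMinimal? F) F _ ⟩
  lubell (filter (nonMinimal? F) F) + lubell mins ≤⟨ +-mono-≤ le (lubell-antichain mins (Unique.filter⁺ _ F!) anti) ⟩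
  k * n ! + n !                                   ≡⟨ +-comm (k * n !) (n !) ⟩
  suc k * n !                                     ∎)
  where
  open ≤-Reasoning
  mins = filter (U.∁? (nonMinimal? F)) F
  anti : ∀ {D E} → D ∈ mins → E ∈ mins → ¬ D ⊂ E
  anti D∈ E∈ D⊂E = proj₂ (∈-filter⁻ (U.∁? (nonMinimal? F)) {xs = F} E∈)
                         (lose (proj₁ (∈-filter⁻ (U.∁? (nonMinimal? F)) D∈)) D⊂E)
... | inj₂ (B , c) with find (proj₂ (∈-filter⁻ (nonMinimal? F) {xs = F} (bottom∈ c)))
...   | A , A∈ , A⊂B = inj₂ (A , step A∈ A⊂B (embed c))
  where
  embed : ∀ {m A} → Chain (filter (nonMinimal? F) F) m A → Chain F m A
  embed [ A∈ ]          = [ proj₁ (∈-filter⁻ (nonMinimal? F) A∈) ]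
  embed (step A∈ A⊂B c) = step (proj₁ (∈-filter⁻ (nonMinimal? F) A∈)) A⊂B (embed c)

-- Families with few members per level below or above each set

-- Equality holds at `i = 0`; raising `i` by one multiplies the left side by `3 + i` and the right
-- side by the no smaller `3 + i + j`.
!*!-≤ : ∀ i j → (2 + i) ! * (2 + j) ! ≤ 2 * (2 + i + j) !
!*!-≤ zero    j = ≤-refl
!*!-≤ (suc i) j = begin
  (3 + i) * (2 + i) ! * (2 + j) !         ≡⟨ *-assoc (3 + i) ((2 + i) !) ((2 + j) !) ⟩
  (3 + i) * ((2 + i) ! * (2 + j) !)       ≤⟨ *-mono-≤ (m≤m+n (3 + i) j) (!*!-≤ i j) ⟩
  (3 + i + j) * (2 * (2 + i + j) !)       ≡⟨ *-swap (3 + i + j) 2 ((2 + i + j) !) ⟩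
  2 * ((3 + i + j) * (2 + i + j) !)       ∎
  where
  open ≤-Reasoning

-- For `d = 2 + e`, only the level `d - 1` has the first-order size `(d - 1) !`. For any other `k`
-- both `k` and `d - k` are at least 2, and `!*!-≤` applies.
!*∸!-≤ : ∀ k e → 2 ≤ k → k < 2 + e → k ! * (2 + e ∸ k) ! ≤ 𝟙 (k ≟ 1 + e) * (1 + e) ! + 2 * e !
!*∸!-≤ k e 2≤k k<2+e with k ≟ 1 + e
... | yes refl rewrite m+n∸n≡m 1 e = ≤-trans (≤-reflexive (*-comm ((1 + e) !) 1)) (m≤m+n _ _)
... | no k≢1+e with m≤n⇒∃[o]m+o≡n 2≤k | m≤n⇒∃[o]m+o≡n (≤-pred (≤∧≢⇒< (≤-pred k<2+e) k≢1+e))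
...   | i , refl | j , refl = begin
  (2 + i) ! * (2 + (2 + i + j) ∸ (2 + i)) !  ≡⟨ cong (λ m → (2 + i) ! * m !) eq ⟩
  (2 + i) ! * (2 + j) !                      ≤⟨ !*!-≤ i j ⟩
  2 * (2 + i + j) !                          ∎
  where
  open ≤-Reasoning
  eq : 2 + (2 + i + j) ∸ (2 + i) ≡ 2 + j
  eq = trans (cong (_∸ (2 + i)) (swap i j)) (m+n∸m≡n (2 + i) (2 + j))
    where
    swap : ∀ i j → 2 + (2 + i + j) ≡ 2 + i + (2 + j)
    swap = solve-∀

module _ (f : X → ℕ) (xs : List X) {a lo e : ℕ} (2≤lo : 2 ≤ lo)
         (lo≤f : ∀ {x} → x ∈ xs → lo ≤ f x) (f<d : ∀ {x} → x ∈ xs → f x < 2 + e)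
         (few : ∀ {i} → i < 2 + e → length (level f i xs) ≤ a) where

  -- At most `a` elements sit on the level next to `2 + e` and are charged the large term; all
  -- elements together occupy at most `ρ` levels, hence number at most `ρ * a`. The abstract `f`
  -- covers both size and codimension.
  ∑-factorials-≤ : ∀ {ρ} → 2 + e ≤ lo + ρ →
    ∑ xs (λ x → f x ! * (2 + e ∸ f x) !) ≤ a * ((1 + e) ! + ρ * (2 * e !))
  ∑-factorials-≤ {ρ} d≤lo+ρ = begin
    ∑ xs (λ x → f x ! * (2 + e ∸ f x) !)
      ≤⟨ ∑-mono xs (λ {x} x∈ → !*∸!-≤ (f x) e (≤-trans 2≤lo (lo≤f x∈)) (f<d x∈)) ⟩
    ∑ xs (λ x → 𝟙 (f x ≟ 1 + e) * (1 + e) ! + 2 * e !)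
      ≡⟨ ∑-+ xs _ _ ⟩
    ∑ xs (λ x → 𝟙 (f x ≟ 1 + e) * (1 + e) !) + ∑ xs (λ _ → 2 * e !)
      ≡⟨ cong₂ _+_ (∑-*ʳ xs ((1 + e) !) _) (∑-const xs (2 * e !)) ⟩
    ∑ xs (λ x → 𝟙 (f x ≟ 1 + e)) * (1 + e) ! + length xs * (2 * e !)
      ≡⟨ cong (λ m → m * (1 + e) ! + length xs * (2 * e !)) (sym (length-filter-∑ (λ x → f x ≟ 1 + e) xs)) ⟩
    length (level f (1 + e) xs) * (1 + e) ! + length xs * (2 * e !)
      ≤⟨ +-mono-≤ (*-monoˡ-≤ _ (few ≤-refl)) (*-monoˡ-≤ _ len) ⟩
    a * (1 + e) ! + ρ * a * (2 * e !)
      ≡⟨ factor a ρ ((1 + e) !) (2 * e !) ⟩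
    a * ((1 + e) ! + ρ * (2 * e !)) ∎
    where
    open ≤-Reasoning
    factor : ∀ a ρ x y → a * x + ρ * a * y ≡ a * (x + ρ * y)
    factor = solve-∀
    levels = applyUpTo (lo +_) (2 + e ∸ lo)
    f∈levels : ∀ {x} → x ∈ xs → f x ∈ levels
    f∈levels {x} x∈ = subst (_∈ levels) (m+[n∸m]≡n (lo≤f x∈)) (∈-applyUpTo⁺ (lo +_) (∸-monoˡ-< (f<d x∈) (lo≤f x∈)))
    few-levels : ∀ {i} → i ∈ levels → length (level f i xs) ≤ a
    few-levels i∈ with ∈-applyUpTo⁻ (lo +_) i∈
    ... | j , j<d∸lo , refl = few (subst (_≤ 2 + e) (cong suc (+-comm j lo)) (m<n∸o⇒m+o<n j lo j<d∸lo))
      where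
      m<n∸o⇒m+o<n : ∀ {n} m o → m < n ∸ o → m + o < n
      m<n∸o⇒m+o<n {n} m o m<n∸o = ≰⇒> (λ n≤m+o → <⇒≱ m<n∸o (m≤n+o⇒m∸n≤o n o (≤-trans n≤m+o (≤-reflexive (+-comm m o)))))
    len : length xs ≤ ρ * a
    len = begin
      length xs                                   ≤⟨ length-by-levels f levels xs f∈levels ⟩
      ∑ levels (λ i → length (level f i xs))      ≤⟨ ∑-mono levels few-levels ⟩
      ∑ levels (λ _ → a)                          ≡⟨ ∑-const levels a ⟩
      length levels * a                           ≡⟨ cong (_* a) (length-applyUpTo (lo +_) (2 + e ∸ lo)) ⟩
      (2 + e ∸ lo) * a                            ≤⟨ *-monoˡ-≤ a (m≤n+o⇒m∸n≤o (2 + e) lo d≤lo+ρ) ⟩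
      ρ * a                                       ∎

-- For d = 2 + e this says 1/d + 2ρ/(d(d − 1)) ≤ (2n + 36ρ)/n²: the level next to D gives 1/d, and each of
-- the at most ρ other levels at most 2/(d(d − 1)).
scaled-≤ : ∀ n ρ e → n ≤ 4 * (1 + e) → n ≤ 2 * (2 + e) + ρ →
           n * n * ((1 + e) ! + ρ * (2 * e !)) ≤ (2 * n + 36 * ρ) * (2 + e) !
scaled-≤ n ρ e n≤4d n≤2d+ρ = begin
  n * n * ((1 + e) ! + ρ * (2 * e !))
    ≡⟨ expand n ρ (1 + e) (e !) ⟩
  (n * (n * (1 + e)) + 2 * ρ * (n * n)) * e !
    ≤⟨ *-monoˡ-≤ (e !) (+-mono-≤ (*-monoʳ-≤ n (*-monoˡ-≤ (1 + e) n≤2d+ρ)) (*-monoʳ-≤ (2 * ρ) (*-mono-≤ n≤4[2+e] n≤4d))) ⟩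
  (n * ((2 * (2 + e) + ρ) * (1 + e)) + 2 * ρ * (4 * (2 + e) * (4 * (1 + e)))) * e !
    ≡⟨ regroup n ρ (1 + e) (2 + e) (e !) ⟩
  (2 * n * (2 + e) * (1 + e) + n * (ρ * (1 + e)) + 32 * ρ * (2 + e) * (1 + e)) * e !
    ≤⟨ *-monoˡ-≤ (e !) (+-monoˡ-≤ _ (+-monoʳ-≤ (2 * n * (2 + e) * (1 + e)) (*-monoˡ-≤ (ρ * (1 + e)) n≤4[2+e]))) ⟩
  (2 * n * (2 + e) * (1 + e) + 4 * (2 + e) * (ρ * (1 + e)) + 32 * ρ * (2 + e) * (1 + e)) * e !
    ≡⟨ collect n ρ (1 + e) (2 + e) (e !) ⟩
  (2 * n + 36 * ρ) * (2 + e) ! ∎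
  where
  open ≤-Reasoning
  n≤4[2+e] : n ≤ 4 * (2 + e)
  n≤4[2+e] = ≤-trans n≤4d (*-monoʳ-≤ 4 (n≤1+n (1 + e)))
  expand : ∀ n ρ d f → n * n * (d * f + ρ * (2 * f)) ≡ (n * (n * d) + 2 * ρ * (n * n)) * f
  expand = solve-∀
  regroup : ∀ n ρ c d f → (n * ((2 * d + ρ) * c) + 2 * ρ * (4 * d * (4 * c))) * f ≡
                          (2 * n * d * c + n * (ρ * c) + 32 * ρ * d * c) * f
  regroup = solve-∀
  collect : ∀ n ρ c d f → (2 * n * d * c + 4 * d * (ρ * c) + 32 * ρ * d * c) * f ≡ (2 * n + 36 * ρ) * (d * (c * f))
  collect = solve-∀

-- The bound on `i` makes the property decidable by finite search; sizes and codimensions never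
-- exceed `n`.
Crowded : ℕ → (Subset n → ℕ) → List (Subset n) → Set
Crowded {n} s f xs = ∃ λ i → i < suc n × s ≤ length (level f i xs)

crowded? : ∀ s (f : Subset n → ℕ) xs → Dec (Crowded s f xs)
crowded? {n} s f xs = anyUpTo? (λ i → s ≤? length (level f i xs)) (suc n)

codim : Subset n → ℕ
codim {n} D = n ∸ ∣ D ∣

codim-∸-codim : (D E : Subset n) → codim D ∸ codim E ≡ ∣ E ∣ ∸ ∣ D ∣
codim-∸-codim {n} D E = trans (∸-+-assoc n ∣ D ∣ (n ∸ ∣ E ∣)) (trans (cong (n ∸_) (+-comm ∣ D ∣ (n ∸ ∣ E ∣)))
  (trans (sym (∸-+-assoc n (n ∸ ∣ E ∣) ∣ D ∣)) (cong (_∸ ∣ D ∣) (m∸[m∸n]≡n (∣p∣≤n E)))))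

-- The sizes occurring in `F` lie in an interval of length at most `ρ`, symmetric about `n / 2`, and
-- `lo - 1` is at least `n / 4`.
module Window (lo ρ : ℕ) (n+4≤4lo : n + 4 ≤ 4 * lo) (n≤2lo+ρ : n ≤ 2 * lo + ρ)
              (F : List (Subset n))
              (lo≤ : ∀ {D} → D ∈ F → lo ≤ ∣ D ∣) (≤n∸lo : ∀ {D} → D ∈ F → ∣ D ∣ ≤ n ∸ lo) where

  -- Combines `∑-factorials-≤` with `scaled-≤`. It is applied to sizes below a set of size `d`, and
  -- dually to codimensions above a set of codimension `d`.
  light-∑-≤ : ∀ {a d} (f : Subset n → ℕ) (xs : List (Subset n)) → 2 ≤ lo → ¬ Crowded (suc a) f xs → lo ≤ d → d ≤ n ∸ lo →
    (∀ {E} → E ∈ xs → lo ≤ f E × f E < d) →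
    n * n * ∑ xs (λ E → f E ! * (d ∸ f E) !) ≤ a * (2 * n + 36 * ρ) * d !
  light-∑-≤ {a} {d} f xs 2≤lo light lo≤d d≤ bounds with m≤n⇒∃[o]m+o≡n (≤-trans 2≤lo lo≤d)
  ... | e , refl = begin
    n * n * ∑ xs (λ E → f E ! * (2 + e ∸ f E) !)
      ≤⟨ *-monoʳ-≤ (n * n) (∑-factorials-≤ f xs {a} {lo} {e} 2≤lo (proj₁ ∘ bounds) (proj₂ ∘ bounds) few d≤lo+ρ) ⟩
    n * n * (a * ((1 + e) ! + ρ * (2 * e !)))
      ≡⟨ *-swap (n * n) a _ ⟩
    a * (n * n * ((1 + e) ! + ρ * (2 * e !)))
      ≤⟨ *-monoʳ-≤ a (scaled-≤ n ρ e n≤4[1+e] (≤-trans n≤2lo+ρ (+-monoˡ-≤ ρ (*-monoʳ-≤ 2 lo≤d)))) ⟩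
    a * ((2 * n + 36 * ρ) * (2 + e) !)
      ≡⟨ *-assoc a _ _ ⟨
    a * (2 * n + 36 * ρ) * (2 + e) ! ∎
    where
    open ≤-Reasoning
    few : ∀ {i} → i < 2 + e → length (level f i xs) ≤ a
    few {i} i<d = ≤-pred (≰⇒> (λ s≤ → light (i , <-≤-trans i<d (≤-trans d≤ (≤-trans (m∸n≤m n lo) (n≤1+n n))) , s≤)))
    n≤4[1+e] : n ≤ 4 * (1 + e)
    n≤4[1+e] = +-cancelʳ-≤ 4 n (4 * (1 + e)) (begin
      n + 4            ≤⟨ n+4≤4lo ⟩
      4 * lo           ≤⟨ *-monoʳ-≤ 4 lo≤d ⟩
      4 * (2 + e)      ≡⟨ four e ⟩
      4 * (1 + e) + 4  ∎)
      where
      four : ∀ e → 4 * (2 + e) ≡ 4 * (1 + e) + 4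
      four = solve-∀
    d≤lo+ρ : 2 + e ≤ lo + ρ
    d≤lo+ρ = ≤-trans d≤ (m≤n+o⇒m∸n≤o n lo (≤-trans n≤2lo+ρ (≤-reflexive (two lo ρ))))
      where
      two : ∀ l r → 2 * l + r ≡ l + (l + r)
      two = solve-∀

  -- `n !` times the expectation of (X choose 2), where X is the number of members of `Y` on a
  -- random maximal chain.
  pairWeight : List (Subset n) → ℕ
  pairWeight Y = ∑ Y (λ D → weightStrictlyBelow Y chains D * (n ∸ ∣ D ∣) !)

  below above : Subset n → List (Subset n)
  below D = filter (_⊂? D) F
  above D = filter (D ⊂?_) F

  module _ (2≤lo : 2 ≤ lo) {ℓ} {P : Pred (Subset n) ℓ} (P? : Decidable P) (a : ℕ) where

    private
      G = filter P? F
      T = 2 * n + 36 * ρ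

    open ≤-Reasoning

    -- Each pair is charged to its upper member `D`. Lightness concerns the members of all of `F`
    -- below `D`, so the inner sum is first enlarged from `G` to `F`.
    pairWeight-downLight : (∀ {D} → P D → ¬ Crowded (suc a) ∣_∣ (below D)) →
                           n * n * pairWeight G ≤ a * T * lubell G
    pairWeight-downLight light = begin
      n * n * pairWeight G
        ≡⟨ ∑-*ˡ G (n * n) _ ⟨
      ∑ G (λ D → n * n * (weightStrictlyBelow G chains D * (n ∸ ∣ D ∣) !))
        ≤⟨ ∑-mono G pointwise ⟩
      ∑ G (λ D → a * T * (∣ D ∣ ! * (n ∸ ∣ D ∣) !))
        ≡⟨ ∑-*ˡ G (a * T) _ ⟩
      a * T * lubell G ∎
      where
      pointwise : ∀ {D} → D ∈ G → n * n * (weightStrictlyBelow G chains D * (n ∸ ∣ D ∣) !) ≤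
                                  a * T * (∣ D ∣ ! * (n ∸ ∣ D ∣) !)
      pointwise {D} D∈G with ∈-filter⁻ P? {xs = F} D∈G
      ... | D∈F , PD = begin
        n * n * (weightStrictlyBelow G chains D * (n ∸ ∣ D ∣) !)
          ≤⟨ *-monoʳ-≤ (n * n) (*-monoˡ-≤ ((n ∸ ∣ D ∣) !) (∑-filter-≤ P? F _)) ⟩
        n * n * (weightStrictlyBelow F chains D * (n ∸ ∣ D ∣) !)
          ≡⟨ cong (λ m → n * n * (m * (n ∸ ∣ D ∣) !)) (∑-filter (_⊂? D) F _) ⟨
        n * n * (∑ (below D) (λ E → ∣ E ∣ ! * (∣ D ∣ ∸ ∣ E ∣) !) * (n ∸ ∣ D ∣) !)
          ≡⟨ *-assoc (n * n) _ _ ⟨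
        n * n * ∑ (below D) (λ E → ∣ E ∣ ! * (∣ D ∣ ∸ ∣ E ∣) !) * (n ∸ ∣ D ∣) !
          ≤⟨ *-monoˡ-≤ ((n ∸ ∣ D ∣) !) (light-∑-≤ ∣_∣ (below D) 2≤lo (light PD) (lo≤ D∈F) (≤n∸lo D∈F) bounds) ⟩
        a * T * ∣ D ∣ ! * (n ∸ ∣ D ∣) !
          ≡⟨ *-assoc (a * T) _ _ ⟩
        a * T * (∣ D ∣ ! * (n ∸ ∣ D ∣) !) ∎
        where
        bounds : ∀ {E} → E ∈ below D → lo ≤ ∣ E ∣ × ∣ E ∣ < ∣ D ∣
        bounds E∈ with ∈-filter⁻ (_⊂? D) {xs = F} E∈
        ... | E∈F , E⊂D = lo≤ E∈F , p⊂q⇒∣p∣<∣q∣ E⊂D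

    -- The dual: after exchanging the two sums, each pair is charged to its lower member, and
    -- codimension takes the place of size.
    pairWeight-upLight : (∀ {D} → P D → ¬ Crowded (suc a) codim (above D)) →
                         n * n * pairWeight G ≤ a * T * lubell G
    pairWeight-upLight light = begin
      n * n * pairWeight G
        ≡⟨ cong (n * n *_) swapped ⟩
      n * n * ∑ G (λ D → ∣ D ∣ ! * ∑ G (λ E → 𝟙 (D ⊂? E) * (codim E ! * (codim D ∸ codim E) !)))
        ≡⟨ ∑-*ˡ G (n * n) _ ⟨
      ∑ G (λ D → n * n * (∣ D ∣ ! * ∑ G (λ E → 𝟙 (D ⊂? E) * (codim E ! * (codim D ∸ codim E) !))))
        ≤⟨ ∑-mono G pointwise ⟩
      ∑ G (λ D → a * T * (∣ D ∣ ! * (n ∸ ∣ D ∣) !))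
        ≡⟨ ∑-*ˡ G (a * T) _ ⟩
      a * T * lubell G ∎
      where
      shuffle : ∀ i x y z → i * (x * y) * z ≡ x * (i * (z * y))
      shuffle = solve-∀
      swapped : pairWeight G ≡ ∑ G (λ D → ∣ D ∣ ! * ∑ G (λ E → 𝟙 (D ⊂? E) * (codim E ! * (codim D ∸ codim E) !)))
      swapped = begin-equality
        ∑ G (λ E → ∑ G (λ D → 𝟙 (D ⊂? E) * (∣ D ∣ ! * (∣ E ∣ ∸ ∣ D ∣) !)) * codim E !)
          ≡⟨ ∑-cong G (λ {E} _ → ∑-*ʳ G (codim E !) _) ⟨
        ∑ G (λ E → ∑ G (λ D → 𝟙 (D ⊂? E) * (∣ D ∣ ! * (∣ E ∣ ∸ ∣ D ∣) !) * codim E !))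
          ≡⟨ ∑-comm G G _ ⟩
        ∑ G (λ D → ∑ G (λ E → 𝟙 (D ⊂? E) * (∣ D ∣ ! * (∣ E ∣ ∸ ∣ D ∣) !) * codim E !))
          ≡⟨ ∑-cong G (λ {D} _ → trans (∑-cong G (λ {E} _ → trans
               (shuffle (𝟙 (D ⊂? E)) (∣ D ∣ !) ((∣ E ∣ ∸ ∣ D ∣) !) (codim E !))
               (cong (λ m → ∣ D ∣ ! * (𝟙 (D ⊂? E) * (codim E ! * m !))) (sym (codim-∸-codim D E)))))
               (∑-*ˡ G (∣ D ∣ !) _)) ⟩
        ∑ G (λ D → ∣ D ∣ ! * ∑ G (λ E → 𝟙 (D ⊂? E) * (codim E ! * (codim D ∸ codim E) !))) ∎
      pointwise : ∀ {D} → D ∈ G →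
        n * n * (∣ D ∣ ! * ∑ G (λ E → 𝟙 (D ⊂? E) * (codim E ! * (codim D ∸ codim E) !))) ≤
        a * T * (∣ D ∣ ! * codim D !)
      pointwise {D} D∈G with ∈-filter⁻ P? {xs = F} D∈G
      ... | D∈F , PD = begin
        n * n * (∣ D ∣ ! * ∑ G (λ E → 𝟙 (D ⊂? E) * (codim E ! * (codim D ∸ codim E) !)))
          ≤⟨ *-monoʳ-≤ (n * n) (*-monoʳ-≤ (∣ D ∣ !) (∑-filter-≤ P? F _)) ⟩
        n * n * (∣ D ∣ ! * ∑ F (λ E → 𝟙 (D ⊂? E) * (codim E ! * (codim D ∸ codim E) !)))
          ≡⟨ cong (λ m → n * n * (∣ D ∣ ! * m)) (∑-filter (D ⊂?_) F _) ⟨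
        n * n * (∣ D ∣ ! * ∑ (above D) (λ E → codim E ! * (codim D ∸ codim E) !))
          ≡⟨ *-swap (n * n) (∣ D ∣ !) _ ⟩
        ∣ D ∣ ! * (n * n * ∑ (above D) (λ E → codim E ! * (codim D ∸ codim E) !))
          ≤⟨ *-monoʳ-≤ (∣ D ∣ !) (light-∑-≤ codim (above D) 2≤lo (light PD) (lo≤codim D∈F) (∸-monoʳ-≤ n (lo≤ D∈F)) bounds) ⟩
        ∣ D ∣ ! * (a * T * codim D !)
          ≡⟨ *-swap (∣ D ∣ !) (a * T) _ ⟩
        a * T * (∣ D ∣ ! * codim D !) ∎
        where
        lo≤codim : ∀ {E} → E ∈ F → lo ≤ codim E
        lo≤codim {E} E∈ = ≤-trans (≤-reflexive (sym (m∸[m∸n]≡n lo≤n))) (∸-monoʳ-≤ n (≤n∸lo E∈))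
          where
          lo≤n : lo ≤ n
          lo≤n = ≤-trans (lo≤ D∈F) (∣p∣≤n D)
        bounds : ∀ {E} → E ∈ above D → lo ≤ codim E × codim E < codim D
        bounds {E} E∈ with ∈-filter⁻ (D ⊂?_) {xs = F} E∈
        ... | E∈F , D⊂E = lo≤codim E∈F , ∸-monoʳ-< (p⊂q⇒∣p∣<∣q∣ D⊂E) (∣p∣≤n E)

-- From chains to the forbidden configuration

lookup-injective : {xs : List X} → Unique xs → ∀ i j → lookup xs i ≡ lookup xs j → i ≡ j
lookup-injective (x∉ ∷ u) zero    zero    eq = refl
lookup-injective (x∉ ∷ u) zero    (suc j) eq = contradiction eq (All.lookup x∉ (∈-lookup j))
lookup-injective (x∉ ∷ u) (suc i) zero    eq = contradiction (sym eq) (All.lookup x∉ (∈-lookup i))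
lookup-injective (x∉ ∷ u) (suc i) (suc j) eq = cong suc (lookup-injective u i j eq)

module _ {G : List (Subset n)} where

  chainAt : ∀ {m A} → Chain G m A → Fin m → Subset n
  chainAt {A = A} [ _ ]        _       = A
  chainAt {A = A} (step _ _ _) zero    = A
  chainAt         (step _ _ c) (suc i) = chainAt c i

  chainAt-∈ : ∀ {m A} (c : Chain G m A) i → chainAt c i ∈ G
  chainAt-∈ [ A∈ ]        _       = A∈
  chainAt-∈ (step A∈ _ _) zero    = A∈
  chainAt-∈ (step _ _ c)  (suc i) = chainAt-∈ c i

  bottom-⊆ : ∀ {m A} (c : Chain G m A) i → A ⊆ chainAt c i
  bottom-⊆ [ _ ]                  _       = ⊆-refl
  bottom-⊆ (step _ _ _)           zero    = ⊆-refl
  bottom-⊆ (step _ (A⊆B , _) c)   (suc i) = ⊆-trans A⊆B (bottom-⊆ c i)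

  chainAt-⊂ : ∀ {m A} (c : Chain G m A) i j → toℕ i < toℕ j → chainAt c i ⊂ chainAt c j
  chainAt-⊂ [ _ ]          zero    (suc ()) _
  chainAt-⊂ (step _ A⊂B c) zero    (suc j) _         = ⊂-⊆-trans A⊂B (bottom-⊆ c j)
  chainAt-⊂ (step _ _ c)   (suc i) (suc j) (s≤s i<j) = chainAt-⊂ c i j i<j

  chainAt-injective : ∀ {m A} (c : Chain G m A) i j → chainAt c i ≡ chainAt c j → i ≡ j
  chainAt-injective c i j eq with <-cmp (toℕ i) (toℕ j)
  ... | tri< i<j _ _ = contradiction (chainAt-⊂ c i j i<j) (⊂-irref eq)
  ... | tri≈ _ i≡j _ = toℕ-injective i≡j
  ... | tri> _ _ j<i = contradiction (chainAt-⊂ c j i j<i) (⊂-irref (sym eq))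

  ⊆-top : ∀ {m A} (c : Chain G (suc m) A) i → chainAt c i ⊆ chainAt c (fromℕ m)
  ⊆-top {m} c i with m≤n⇒m<n∨m≡n (≤fromℕ i)
  ... | inj₁ i<m = proj₁ (chainAt-⊂ c i (fromℕ m) i<m)
  ... | inj₂ i≡m = ⊆-reflexive (cong (chainAt c) (toℕ-injective i≡m))

-- One fan of the configuration: the A_i with `f` the size, or the C_j with `f` the codimension.
record EqualSized (s : ℕ) (f : Subset n → ℕ) (xs : List (Subset n)) : Set where
  field
    pick           : Fin s → Subset n
    pick-∈         : ∀ i → pick i ∈ xs
    pick-injective : ∀ i j → pick i ≡ pick j → i ≡ j
    pick-size      : ∀ i j → f (pick i) ≡ f (pick j)

crowded⇒equalSized : ∀ {s} {f : Subset n → ℕ} {xs} → Unique xs → Crowded s f xs → EqualSized s f xs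
crowded⇒equalSized {s = s} {f} {xs} xs! (i₀ , _ , s≤) = record
  { pick           = λ i → lookup (level f i₀ xs) (inject≤ i s≤)
  ; pick-∈         = λ i → proj₁ (spec i)
  ; pick-injective = λ i j eq → inject≤-injective _ _ i j (lookup-injective (Unique.filter⁺ _ xs!) _ _ eq)
  ; pick-size      = λ i j → trans (proj₂ (spec i)) (sym (proj₂ (spec j)))
  }
  where
  spec : ∀ i → lookup (level f i₀ xs) (inject≤ i s≤) ∈ xs × f (lookup (level f i₀ xs) (inject≤ i s≤)) ≡ i₀
  spec i = ∈-filter⁻ (λ D → f D ≟ i₀) {xs = xs} (∈-lookup (inject≤ i s≤))

-- The chain supplies the B_k. Sets strictly below its bottom or strictly above its top are strictly
-- comparable to the whole chain, which gives all distinctness between the three groups.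
assemble : ∀ {s t k A} {F G : List (Subset n)} → (∀ {D} → D ∈ G → D ∈ F) → (c : Chain G (suc k) A) →
           EqualSized s ∣_∣ (filter (_⊂? A) F) →
           EqualSized t codim (filter (chainAt c (fromℕ k) ⊂?_) F) →
           Config n s t (3 + k) F
assemble {n = n} {s} {t} {k} {A} {F} G⊆F c lowers uppers = record
  { A       = pick lowers
  ; B       = chainAt c
  ; C       = pick uppers
  ; A∈F     = λ i → proj₁ (lower i)
  ; B∈F     = λ k → G⊆F (chainAt-∈ c k)
  ; C∈F     = λ j → proj₁ (upper j)
  ; A-inj   = pick-injective lowers
  ; B-inj   = chainAt-injective c
  ; C-inj   = pick-injective uppers
  ; A≢B     = λ i k eq → ⊂-irref eq (lower-⊂ i k)
  ; A≢C     = λ i j eq → ⊂-irref eq (⊂-trans (lower-⊂ i zero) (⊂-upper zero j))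
  ; B≢C     = λ k j eq → ⊂-irref eq (⊂-upper k j)
  ; A⊆B     = λ i k → proj₁ (lower-⊂ i k)
  ; B-chain = chainAt-⊂ c
  ; B⊆C     = λ k j → proj₁ (⊂-upper k j)
  ; A-size  = pick-size lowers
  ; C-size  = λ j j′ → ∸-cancelˡ-≡ (∣p∣≤n (pick uppers j)) (∣p∣≤n (pick uppers j′)) (pick-size uppers j j′)
  }
  where
  open EqualSized
  lower : ∀ i → pick lowers i ∈ F × pick lowers i ⊂ A
  lower i = ∈-filter⁻ (_⊂? A) {xs = F} (pick-∈ lowers i)
  upper : ∀ j → pick uppers j ∈ F × chainAt c (fromℕ k) ⊂ pick uppers j
  upper j = ∈-filter⁻ (chainAt c (fromℕ k) ⊂?_) {xs = F} (pick-∈ uppers j)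
  lower-⊂ : ∀ i k → pick lowers i ⊂ chainAt c k
  lower-⊂ i k = ⊂-⊆-trans (proj₂ (lower i)) (bottom-⊆ c k)
  ⊂-upper : ∀ k j → chainAt c k ⊂ pick uppers j
  ⊂-upper k j = ⊆-⊂-trans (⊆-top c k) (proj₂ (upper j))

Between : List (Subset n) → ℕ → ℕ → Subset n → Set
Between F s t D = Crowded s ∣_∣ (filter (_⊂? D) F) × Crowded t codim (filter (D ⊂?_) F)

between? : (F : List (Subset n)) → ∀ s t → Decidable (Between F s t)
between? F s t D = crowded? s ∣_∣ (filter (_⊂? D) F) ×-dec crowded? t codim (filter (D ⊂?_) F)

-- The bottom set of the chain supplies the A_i and the top set the C_j, both chosen from all of
-- `F`. The `suc k` chain members are the h - 2 sets B_k for `h = 3 + k`.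
chain⇒config : ∀ {s t k A} (F : List (Subset n)) → Unique F →
               Chain (filter (between? F s t) F) (suc k) A → Config n s t (3 + k) F
chain⇒config {s = s} {t} {k} {A} F F! c =
  assemble (λ D∈ → proj₁ (∈-filter⁻ (between? F s t) D∈)) c
    (crowded⇒equalSized (Unique.filter⁺ (_⊂? A) F!) (proj₁ (proj₂ (∈-filter⁻ (between? F s t) {xs = F} (bottom∈ c)))))
    (crowded⇒equalSized (Unique.filter⁺ (chainAt c (fromℕ k) ⊂?_) F!)
      (proj₂ (proj₂ (∈-filter⁻ (between? F s t) {xs = F} (chainAt-∈ c (fromℕ k))))))

-- W ≤ N + ε W gives W ≤ N (1 + ε + 2 ε²) for ε = a (2 n + 36 ρ) / n² ≤ 1/2.
bootstrap : ∀ n ρ a W N → .{{_ : NonZero n}} → 36 * ρ ≤ n → 6 * a ≤ n → 1 ≤ ρ →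
            n * n * W ≤ n * n * N + a * (2 * n + 36 * ρ) * W →
            n * n * W ≤ N * (n * n + 2 * a * n + (36 * a + 18 * (a * a)) * ρ)
bootstrap n ρ a W N 36ρ≤n 6a≤n 1≤ρ hyp = begin
  n * n * W
    ≤⟨ hyp ⟩
  n * n * N + a * T * W
    ≤⟨ +-monoʳ-≤ (n * n * N) second ⟩
  n * n * N + (a * T * N + 18 * (a * a) * N)
    ≡⟨ expand n ρ a N ⟩
  N * (n * n + 2 * a * n + (36 * a * ρ + 18 * (a * a) * 1))
    ≤⟨ *-monoʳ-≤ N (+-monoʳ-≤ (n * n + 2 * a * n) (+-monoʳ-≤ (36 * a * ρ) (*-monoʳ-≤ (18 * (a * a)) 1≤ρ))) ⟩
  N * (n * n + 2 * a * n + (36 * a * ρ + 18 * (a * a) * ρ))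
    ≡⟨ cong (λ m → N * (n * n + 2 * a * n + m)) (*-distribʳ-+ ρ (36 * a) (18 * (a * a))) ⟨
  N * (n * n + 2 * a * n + (36 * a + 18 * (a * a)) * ρ) ∎
  where
  open ≤-Reasoning
  T = 2 * n + 36 * ρ
  T≤3n : T ≤ 3 * n
  T≤3n = ≤-trans (+-monoʳ-≤ (2 * n) 36ρ≤n) (≤-reflexive (three n))
    where
    three : ∀ n → 2 * n + n ≡ 3 * n
    three = solve-∀
  expand : ∀ n ρ a N → n * n * N + (a * (2 * n + 36 * ρ) * N + 18 * (a * a) * N) ≡
                       N * (n * n + 2 * a * n + (36 * a * ρ + 18 * (a * a) * 1))
  expand = solve-∀
  instance
    n²≢0 : NonZero (n * n)
    n²≢0 = m*n≢0 n n
  -- A crude bound first: `T ≤ 3 * n` and `6 * a ≤ n` give ε ≤ 1/2, so twice the hypothesis already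
  -- yields W ≤ 2 N.
  first : W ≤ 2 * N
  first = *-cancelˡ-≤ (n * n) (+-cancelʳ-≤ (n * n * W) (n * n * W) (n * n * (2 * N)) (begin
    n * n * W + n * n * W                   ≤⟨ +-mono-≤ hyp hyp ⟩
    n * n * N + a * T * W + (n * n * N + a * T * W)
      ≤⟨ +-mono-≤ (+-monoʳ-≤ (n * n * N) aTW) (+-monoʳ-≤ (n * n * N) aTW) ⟩
    n * n * N + a * (3 * n) * W + (n * n * N + a * (3 * n) * W) ≡⟨ collect n a W N ⟩
    n * n * (2 * N) + 6 * a * (n * W)       ≤⟨ +-monoʳ-≤ (n * n * (2 * N)) (*-monoˡ-≤ (n * W) 6a≤n) ⟩
    n * n * (2 * N) + n * (n * W)           ≡⟨ cong (n * n * (2 * N) +_) (*-assoc n n W) ⟨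
    n * n * (2 * N) + n * n * W             ∎))
    where
    aTW : a * T * W ≤ a * (3 * n) * W
    aTW = *-monoˡ-≤ W (*-monoʳ-≤ a T≤3n)
    collect : ∀ n a W N → n * n * N + a * (3 * n) * W + (n * n * N + a * (3 * n) * W) ≡
                          n * n * (2 * N) + 6 * a * (n * W)
    collect = solve-∀
  -- The hypothesis is inserted once into ε W and the crude bound into the remaining ε² W; the 18 is
  -- 2 · 3 · 3 from `T ≤ 3 * n` used twice.
  second : a * T * W ≤ a * T * N + 18 * (a * a) * N
  second = *-cancelˡ-≤ (n * n) (begin
    n * n * (a * T * W)                     ≡⟨ *-swap (n * n) (a * T) W ⟩
    a * T * (n * n * W)                     ≤⟨ *-monoʳ-≤ (a * T) hyp ⟩
    a * T * (n * n * N + a * T * W)         ≤⟨ *-monoʳ-≤ (a * T) (+-monoʳ-≤ (n * n * N) (*-monoʳ-≤ (a * T) first)) ⟩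
    a * T * (n * n * N + a * T * (2 * N))   ≡⟨ split (n * n) a T N ⟩
    n * n * (a * T * N) + 2 * (a * a) * N * (T * T)
      ≤⟨ +-monoʳ-≤ (n * n * (a * T * N)) (*-monoʳ-≤ (2 * (a * a) * N) (*-mono-≤ T≤3n T≤3n)) ⟩
    n * n * (a * T * N) + 2 * (a * a) * N * (3 * n * (3 * n)) ≡⟨ merge n a (a * T * N) N ⟩
    n * n * (a * T * N + 18 * (a * a) * N)  ∎)
    where
    split : ∀ m a T N → a * T * (m * N + a * T * (2 * N)) ≡ m * (a * T * N) + 2 * (a * a) * N * (T * T)
    split = solve-∀
    merge : ∀ n a x N → n * n * x + 2 * (a * a) * N * (3 * n * (3 * n)) ≡ n * n * (x + 18 * (a * a) * N)
    merge = solve-∀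

-- The Lubell function of a family without the configuration

∑-cover : ∀ {p q r} {P : Pred X p} {Q : Pred X q} {R : Pred X r}
          (P? : Decidable P) (Q? : Decidable Q) (R? : Decidable R) → (∀ x → P x ⊎ Q x ⊎ R x) →
          (xs : List X) (w : X → ℕ) → ∑ xs w ≤ ∑ (filter P? xs) w + (∑ (filter Q? xs) w + ∑ (filter R? xs) w)
∑-cover P? Q? R? total xs w = begin
  ∑ xs w
    ≤⟨ ∑-mono xs (λ {x} _ → pointwise x) ⟩
  ∑ xs (λ x → p x + (q x + r x))
    ≡⟨ trans (∑-+ xs p (λ x → q x + r x)) (cong (∑ xs p +_) (∑-+ xs q r)) ⟩
  ∑ xs p + (∑ xs q + ∑ xs r)
    ≡⟨ cong₂ _+_ (∑-filter P? xs w) (cong₂ _+_ (∑-filter Q? xs w) (∑-filter R? xs w)) ⟨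
  ∑ (filter P? xs) w + (∑ (filter Q? xs) w + ∑ (filter R? xs) w) ∎
  where
  open ≤-Reasoning
  p q r : _ → ℕ
  p x = 𝟙 (P? x) * w x
  q x = 𝟙 (Q? x) * w x
  r x = 𝟙 (R? x) * w x
  𝟙-*-yes : ∀ {ℓ} {A : Set ℓ} (A? : Dec A) → A → ∀ m → m ≤ 𝟙 A? * m
  𝟙-*-yes A? a m = ≤-reflexive (sym (trans (cong (_* m) (𝟙-yes A? a)) (*-identityˡ m)))
  pointwise : ∀ x → w x ≤ p x + (q x + r x)
  pointwise x with total x
  ... | inj₁ px        = ≤-trans (𝟙-*-yes (P? x) px (w x)) (m≤m+n (p x) _)
  ... | inj₂ (inj₁ qx) = ≤-trans (𝟙-*-yes (Q? x) qx (w x)) (≤-trans (m≤m+n (q x) (r x)) (m≤n+m _ (p x)))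
  ... | inj₂ (inj₂ rx) = ≤-trans (𝟙-*-yes (R? x) rx (w x)) (≤-trans (m≤n+m (r x) (q x)) (m≤n+m _ (p x)))

-- The coefficient of `ρ` that `bootstrap` produces.
lightError : ℕ → ℕ
lightError a = 36 * a + 18 * (a * a)

module _ (lo ρ : ℕ) .{{_ : NonZero n}} (n+4≤4lo : n + 4 ≤ 4 * lo) (2≤lo : 2 ≤ lo) (n≤2lo+ρ : n ≤ 2 * lo + ρ)
         (36ρ≤n : 36 * ρ ≤ n) (1≤ρ : 1 ≤ ρ)
         (F : List (Subset n)) (F! : Unique F)
         (lo≤ : ∀ {D} → D ∈ F → lo ≤ ∣ D ∣) (≤n∸lo : ∀ {D} → D ∈ F → ∣ D ∣ ≤ n ∸ lo) where

  open Window lo ρ n+4≤4lo n≤2lo+ρ F lo≤ ≤n∸lo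

  -- The down-light and the up-light members contribute one unit `n !` each, up to the error terms,
  -- and the remaining members at most `k` units, since a chain of `suc k` of them would give a
  -- configuration. With `h = 3 + k` this makes h - 1 units.
  lubell-≤ : ∀ {a b k} → 6 * a ≤ n → 6 * b ≤ n → ¬ Config n (1 + a) (1 + b) (3 + k) F →
    n * n * lubell F ≤ n ! * ((2 + k) * (n * n) + 2 * (a + b) * n + (lightError a + lightError b) * ρ)
  lubell-≤ {a} {b} {k} 6a≤n 6b≤n no-config = begin
    n * n * lubell F
      ≤⟨ *-monoʳ-≤ (n * n) cover ⟩
    n * n * (lubell 𝓓 + (lubell 𝓤 + lubell 𝓖))
      ≡⟨ distrib (n * n) (lubell 𝓓) (lubell 𝓤) (lubell 𝓖) ⟩
    n * n * lubell 𝓓 + (n * n * lubell 𝓤 + n * n * lubell 𝓖)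
      ≤⟨ +-mono-≤ (light-bound a 6a≤n 𝓓 𝓓! (pairWeight-downLight 2≤lo downLight? a (λ light → light)))
          (+-mono-≤ (light-bound b 6b≤n 𝓤 𝓤! (pairWeight-upLight 2≤lo upLight? b (λ light → light)))
                    (*-monoʳ-≤ (n * n) 𝓖-bound)) ⟩
    n ! * (n * n + 2 * a * n + lightError a * ρ) +
      (n ! * (n * n + 2 * b * n + lightError b * ρ) + n * n * (k * n !))
      ≡⟨ collect (n !) (n * n) a b n k (lightError a) (lightError b) ρ ⟩
    n ! * ((2 + k) * (n * n) + 2 * (a + b) * n + (lightError a + lightError b) * ρ) ∎
    where
    open ≤-Reasoning
    downLight? : Decidable (λ D → ¬ Crowded (suc a) ∣_∣ (below D))
    downLight? D = ¬? (crowded? (suc a) ∣_∣ (below D))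
    upLight? : Decidable (λ D → ¬ Crowded (suc b) codim (above D))
    upLight? D = ¬? (crowded? (suc b) codim (above D))
    𝓓 = filter downLight? F
    𝓤 = filter upLight? F
    𝓖 = filter (between? F (suc a) (suc b)) F
    𝓓! = Unique.filter⁺ downLight? F!
    𝓤! = Unique.filter⁺ upLight? F!
    distrib : ∀ x u v w → x * (u + (v + w)) ≡ x * u + (x * v + x * w)
    distrib = solve-∀
    collect : ∀ N m a b n k x y ρ →
      N * (m + 2 * a * n + x * ρ) + (N * (m + 2 * b * n + y * ρ) + m * (k * N)) ≡
      N * ((2 + k) * m + 2 * (a + b) * n + (x + y) * ρ)
    collect = solve-∀
    𝓖-bound : lubell 𝓖 ≤ k * n !
    𝓖-bound with lubell-chain k 𝓖 (Unique.filter⁺ _ F!)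
    ... | inj₁ le      = le
    ... | inj₂ (A , c) = contradiction (chain⇒config F F! c) no-config
    light-bound : ∀ a → 6 * a ≤ n → (Y : List (Subset n)) → Unique Y →
      n * n * pairWeight Y ≤ a * (2 * n + 36 * ρ) * lubell Y →
      n * n * lubell Y ≤ n ! * (n * n + 2 * a * n + lightError a * ρ)
    light-bound a 6a≤n Y Y! pairs = bootstrap n ρ a (lubell Y) (n !) 36ρ≤n 6a≤n 1≤ρ (begin
      n * n * lubell Y                       ≤⟨ *-monoʳ-≤ (n * n) (lubell-≤-pairs Y Y!) ⟩
      n * n * (n ! + pairWeight Y)           ≡⟨ *-distribˡ-+ (n * n) (n !) (pairWeight Y) ⟩
      n * n * n ! + n * n * pairWeight Y     ≤⟨ +-monoʳ-≤ (n * n * n !) pairs ⟩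
      n * n * n ! + a * (2 * n + 36 * ρ) * lubell Y ∎)
    cover : lubell F ≤ lubell 𝓓 + (lubell 𝓤 + lubell 𝓖)
    cover = ∑-cover downLight? upLight? (between? F (suc a) (suc b)) trichotomy F _
      where
      trichotomy : ∀ D → ¬ Crowded (suc a) ∣_∣ (below D) ⊎ ¬ Crowded (suc b) codim (above D) ⊎ Between F (suc a) (suc b) D
      trichotomy D with crowded? (suc a) ∣_∣ (below D) | crowded? (suc b) codim (above D)
      ... | no  ¬c | _      = inj₁ ¬c
      ... | yes _  | no  ¬c = inj₂ (inj₁ ¬c)
      ... | yes c  | yes c′ = inj₂ (inj₂ (c , c′))

-- Weights of levels and unimodality

-- The number of maximal chains through a given set of size `i`, that is, `n !` divided by (n choose
-- i).
weight : ℕ → ℕ → ℕ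
weight n i = i ! * (n ∸ i) !

C*weight : ∀ {n i} → i ≤ n → (n C i) * weight n i ≡ n !
C*weight {n} {i} i≤n = trans (cong (_* weight n i) (nCk≡n!/k![n-k]! i≤n)) (m/n*n≡m (k![n∸k]!∣n! i≤n))
  where instance _ = i !* (n ∸ i) !≢0

!*!-shift : ∀ a b x → a ≤ b → (a + x) ! * b ! ≤ a ! * (b + x) !
!*!-shift a b zero    a≤b rewrite +-identityʳ a | +-identityʳ b = ≤-refl
!*!-shift a b (suc x) a≤b rewrite +-suc a x | +-suc b x = begin
  suc (a + x) * (a + x) ! * b !       ≡⟨ *-assoc (suc (a + x)) ((a + x) !) (b !) ⟩
  suc (a + x) * ((a + x) ! * b !)     ≤⟨ *-mono-≤ (s≤s (+-monoˡ-≤ x a≤b)) (!*!-shift a b x a≤b) ⟩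
  suc (b + x) * (a ! * (b + x) !)     ≡⟨ *-swap (suc (b + x)) (a !) ((b + x) !) ⟩
  a ! * (suc (b + x) * (b + x) !)     ∎
  where
  open ≤-Reasoning

-- Log-convexity of the factorial: with a fixed sum, the pair further apart has the larger product.
-- This is the source of unimodality below.
!*!-spread : ∀ {a b c d} → a + d ≡ b + c → a ≤ b → a ≤ c → b ! * c ! ≤ a ! * d !
!*!-spread {a} {b} {c} {d} eq a≤b a≤c with m≤n⇒∃[o]m+o≡n a≤b
... | x , refl = subst (λ m → (a + x) ! * c ! ≤ a ! * m !) (sym d≡c+x) (!*!-shift a c x a≤c)
  where
  d≡c+x : d ≡ c + x
  d≡c+x = +-cancelˡ-≡ a d (c + x) (trans eq (trans (+-assoc a x c) (cong (a +_) (+-comm x c))))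

lubell-level : (F : List (Subset n)) → Unique F → ∀ i → length (level ∣_∣ i F) * weight n i ≤ n !
lubell-level {n} F F! i = begin
  length L * weight n i     ≡⟨ ∑-const L (weight n i) ⟨
  ∑ L (λ _ → weight n i)    ≡⟨ ∑-cong L (λ D∈ → cong (weight n) (sym (size D∈))) ⟩
  lubell L                  ≤⟨ lubell-antichain L (Unique.filter⁺ _ F!)
                                 (λ D∈ E∈ D⊂E → <⇒≢ (p⊂q⇒∣p∣<∣q∣ D⊂E) (trans (size D∈) (sym (size E∈)))) ⟩
  n !                       ∎
  where
  open ≤-Reasoning
  L = level ∣_∣ i F
  size : ∀ {D} → D ∈ L → ∣ D ∣ ≡ i
  size D∈ = proj₂ (∈-filter⁻ (λ D → ∣ D ∣ ≟ i) {xs = F} D∈)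

level-≤-C : (F : List (Subset n)) → Unique F → ∀ {i} → i ≤ n → length (level ∣_∣ i F) ≤ n C i
level-≤-C {n} F F! {i} i≤n = *-cancelʳ-≤ _ _ (weight n i)
  (≤-trans (lubell-level F F! i) (≤-reflexive (sym (C*weight i≤n))))
  where instance _ = i !* (n ∸ i) !≢0

-- The κ middle levels of [κ + q + l] are l, …, l + κ ∸ 1, and l + κ is a largest level among the others.
module Middle {n} (κ l q : ℕ) (n≡ : n ≡ κ + (q + l)) (q≤l : q ≤ l) (l≤1+q : l ≤ 1 + q) where

  p M : ℕ
  p = l + κ
  M = n C p

  q+p≡n : q + p ≡ n
  q+p≡n = trans (rearrange q l κ) (sym n≡)
    where
    rearrange : ∀ q l κ → q + (l + κ) ≡ κ + (q + l)
    rearrange = solve-∀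

  p≤n : p ≤ n
  p≤n = ≤-trans (m≤n+m p q) (≤-reflexive q+p≡n)

  q≤p : q ≤ p
  q≤p = ≤-trans q≤l (m≤m+n l κ)

  n∸p≡q : n ∸ p ≡ q
  n∸p≡q = trans (cong (_∸ p) (sym q+p≡n)) (m+n∸n≡m q p)

  M*weight : M * weight n p ≡ n !
  M*weight = C*weight p≤n

  weight-p : weight n p ≡ q ! * p !
  weight-p = trans (cong (λ m → p ! * m !) n∸p≡q) (*-comm (p !) (q !))

  module _ {i} (i≤n : i ≤ n) where

    private
      j = n ∸ i
      i+j≡n : i + j ≡ n
      i+j≡n = m+[n∸m]≡n i≤n

    -- As `q + p = n`, sizes between `q` and `p` are at least as central as `p`; in terms of
    -- binomial coefficients, `M ≤ n C i`. Dually, `outer` says `n C i ≤ M`.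
    inner : q ≤ i → i ≤ p → M * weight n i ≤ n !
    inner q≤i i≤p = ≤-trans (*-monoʳ-≤ M (≤-trans (!*!-spread (trans q+p≡n (sym i+j≡n)) q≤i q≤j) (≤-reflexive (sym weight-p))))
                            (≤-reflexive M*weight)
      where
      q≤j : q ≤ j
      q≤j = ≤-trans (≤-reflexive (sym n∸p≡q)) (∸-monoʳ-≤ n i≤p)

    outer : i ≤ q ⊎ p ≤ i → n ! ≤ M * weight n i
    outer i≤q⊎p≤i = ≤-trans (≤-reflexive (sym M*weight)) (*-monoʳ-≤ M (≤-trans (≤-reflexive weight-p) (bound i≤q⊎p≤i)))
      where
      bound : i ≤ q ⊎ p ≤ i → q ! * p ! ≤ i ! * j !
      bound (inj₁ i≤q) = !*!-spread (trans i+j≡n (sym q+p≡n)) i≤q (≤-trans i≤q q≤p)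
      bound (inj₂ p≤i) = ≤-trans (!*!-spread (trans (+-comm j i) (trans i+j≡n (sym q+p≡n))) j≤q (≤-trans j≤q q≤p))
                                 (≤-reflexive (*-comm (j !) (i !)))
        where
        j≤q : j ≤ q
        j≤q = ≤-trans (∸-monoʳ-≤ n p≤i) (≤-reflexive n∸p≡q)

  Top : Pred (Subset n) _
  Top D = l ≤ ∣ D ∣ × ∣ D ∣ < p

  top? : Decidable Top
  top? D = (l ≤? ∣ D ∣) ×-dec (∣ D ∣ <? p)

  -- `n !` times what remains of one set on level `i` after its Lubell share 1 / (n choose i) has
  -- been valued at `M`. It is 0 where `outer` applies.
  excess : ℕ → ℕ
  excess i = n ! ∸ M * weight n i

  -- A full level has Lubell share 1, so its excess is `n !` times `(n C i) - M`; the subtracted `M`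
  -- is moved to the other side.
  ∑-excess : κ * (M * n !) + ∑ (upTo κ) (λ j → (n C (l + j)) * excess (l + j)) ≡ n ! * ∑ (upTo κ) (λ j → n C (l + j))
  ∑-excess = begin-equality
    κ * (M * n !) + ∑ (upTo κ) (λ j → (n C (l + j)) * excess (l + j))
      ≡⟨ cong (_+ ∑ (upTo κ) (λ j → (n C (l + j)) * excess (l + j)))
           (trans (cong (_* (M * n !)) (sym (length-upTo κ))) (sym (∑-const (upTo κ) (M * n !)))) ⟩
    ∑ (upTo κ) (λ _ → M * n !) + ∑ (upTo κ) (λ j → (n C (l + j)) * excess (l + j))
      ≡⟨ ∑-+ (upTo κ) (λ _ → M * n !) (λ j → (n C (l + j)) * excess (l + j)) ⟨
    ∑ (upTo κ) (λ j → M * n ! + (n C (l + j)) * excess (l + j))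
      ≡⟨ ∑-cong (upTo κ) (λ j∈ → pointwise (∈-upTo⁻ j∈)) ⟩
    ∑ (upTo κ) (λ j → n ! * (n C (l + j)))
      ≡⟨ ∑-*ˡ (upTo κ) (n !) (λ j → n C (l + j)) ⟩
    n ! * ∑ (upTo κ) (λ j → n C (l + j)) ∎
    where
    open ≤-Reasoning
    pointwise : ∀ {j} → j < κ → M * n ! + (n C (l + j)) * excess (l + j) ≡ n ! * (n C (l + j))
    pointwise {j} j<κ = begin-equality
      M * n ! + c * excess i                 ≡⟨ cong (λ m → M * m + c * excess i) (C*weight i≤n) ⟨
      M * (c * weight n i) + c * excess i    ≡⟨ cong (_+ c * excess i) (*-swap M c (weight n i)) ⟩
      c * (M * weight n i) + c * excess i    ≡⟨ *-distribˡ-+ c (M * weight n i) (excess i) ⟨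
      c * (M * weight n i + excess i)        ≡⟨ cong (c *_) (m+[n∸m]≡n (inner i≤n (≤-trans q≤l (m≤m+n l j)) i≤p)) ⟩
      c * n !                                ≡⟨ *-comm c (n !) ⟩
      n ! * c                                ∎
      where
      i = l + j
      c = n C i
      i≤p : i ≤ p
      i≤p = +-monoʳ-≤ l (<⇒≤ j<κ)
      i≤n : i ≤ n
      i≤n = ≤-trans i≤p p≤n

  -- Every set counts as at most its excess plus `M` times its Lubell share. Excess arises only on
  -- the `κ` middle levels, where it is largest if these levels are full.
  length-≤-lubell : (F : List (Subset n)) → Unique F →
    length F * n ! + κ * (M * n !) ≤ n ! * ∑ (upTo κ) (λ j → n C (l + j)) + M * lubell F
  length-≤-lubell F F! = begin
    length F * n ! + κ * (M * n !)
      ≤⟨ +-monoˡ-≤ (κ * (M * n !)) length-bound ⟩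
    S + M * lubell F + κ * (M * n !)
      ≡⟨ rearrange S (M * lubell F) (κ * (M * n !)) ⟩
    κ * (M * n !) + S + M * lubell F
      ≡⟨ cong (_+ M * lubell F) ∑-excess ⟩
    n ! * ∑ (upTo κ) (λ j → n C (l + j)) + M * lubell F ∎
    where
    open ≤-Reasoning
    rearrange : ∀ x y z → x + y + z ≡ z + x + y
    rearrange = solve-∀
    S = ∑ (upTo κ) (λ j → (n C (l + j)) * excess (l + j))
    Ft = filter top? F
    Fo = filter (U.∁? top?) F
    tops = map (l +_) (upTo κ)
    size∈tops : ∀ {D} → D ∈ Ft → ∣ D ∣ ∈ tops
    size∈tops {D} D∈ with ∈-filter⁻ top? {xs = F} D∈
    ... | _ , l≤ , <p = subst (_∈ tops) (m+[n∸m]≡n l≤)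
      (∈-map⁺ (l +_) (∈-upTo⁺ (subst (∣ D ∣ ∸ l <_) (m+n∸m≡n l κ) (∸-monoˡ-< <p l≤))))
    level-excess : ∀ i → ∑ (level ∣_∣ i Ft) (λ D → excess ∣ D ∣) ≡ length (level ∣_∣ i Ft) * excess i
    level-excess i = trans (∑-cong (level ∣_∣ i Ft) (λ D∈ → cong excess (proj₂ (∈-filter⁻ (λ D → ∣ D ∣ ≟ i) {xs = Ft} D∈))))
                           (∑-const (level ∣_∣ i Ft) (excess i))
    top-excess : ∑ Ft (λ D → excess ∣ D ∣) ≤ S
    top-excess = begin
      ∑ Ft (λ D → excess ∣ D ∣)
        ≤⟨ ∑-by-levels ∣_∣ (λ D → excess ∣ D ∣) tops Ft size∈tops ⟩
      ∑ tops (λ i → ∑ (level ∣_∣ i Ft) (λ D → excess ∣ D ∣))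
        ≡⟨ ∑-map (l +_) (upTo κ) _ ⟩
      ∑ (upTo κ) (λ j → ∑ (level ∣_∣ (l + j) Ft) (λ D → excess ∣ D ∣))
        ≡⟨ ∑-cong (upTo κ) (λ {j} _ → level-excess (l + j)) ⟩
      ∑ (upTo κ) (λ j → length (level ∣_∣ (l + j) Ft) * excess (l + j))
        ≤⟨ ∑-mono (upTo κ) (λ {j} j∈ → *-monoˡ-≤ (excess (l + j)) (level-≤-C Ft (Unique.filter⁺ top? F!)
             (≤-trans (+-monoʳ-≤ l (<⇒≤ (∈-upTo⁻ j∈))) p≤n))) ⟩
      S ∎
    other-excess : ∑ Fo (λ D → excess ∣ D ∣) ≡ 0
    other-excess = trans (∑-cong Fo (λ {D} D∈ → m≤n⇒m∸n≡0 (outer (∣p∣≤n D) (side D∈))))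
                         (trans (∑-const Fo 0) (*-zeroʳ (length Fo)))
      where
      side : ∀ {D} → D ∈ Fo → ∣ D ∣ ≤ q ⊎ p ≤ ∣ D ∣
      side {D} D∈ with l ≤? ∣ D ∣
      ... | no  l≰ = inj₁ (≤-pred (≤-trans (≰⇒> l≰) l≤1+q))
      ... | yes l≤ = inj₂ (≮⇒≥ (λ <p → proj₂ (∈-filter⁻ (U.∁? top?) {xs = F} D∈) (l≤ , <p)))
    length-bound : length F * n ! ≤ S + M * lubell F
    length-bound = begin
      length F * n !
        ≡⟨ ∑-const F (n !) ⟨
      ∑ F (λ _ → n !)
        ≤⟨ ∑-mono F (λ {D} _ → ≤-trans (m≤n+m∸n (n !) (M * weight n ∣ D ∣))
                                        (≤-reflexive (+-comm (M * weight n ∣ D ∣) (excess ∣ D ∣)))) ⟩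
      ∑ F (λ D → excess ∣ D ∣ + M * weight n ∣ D ∣)
        ≡⟨ ∑-+ F (λ D → excess ∣ D ∣) (λ D → M * weight n ∣ D ∣) ⟩
      ∑ F (λ D → excess ∣ D ∣) + ∑ F (λ D → M * weight n ∣ D ∣)
        ≡⟨ cong₂ _+_ (∑-split top? F (λ D → excess ∣ D ∣)) (∑-*ˡ F M (λ D → weight n ∣ D ∣)) ⟩
      ∑ Ft (λ D → excess ∣ D ∣) + ∑ Fo (λ D → excess ∣ D ∣) + M * lubell F
        ≤⟨ +-monoˡ-≤ (M * lubell F) (≤-trans (+-mono-≤ top-excess (≤-reflexive other-excess)) (≤-reflexive (+-identityʳ S))) ⟩
      S + M * lubell F ∎

  -- By unimodality each level outside the window has weight at least `t` times that of level `p`,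
  -- so it holds at most `M / t` members; there are at most `suc n` such levels.
  tail-≤ : ∀ {lo t} → lo + lo ≤ n → t * weight n p ≤ weight n lo → (F : List (Subset n)) → Unique F →
           (∀ {D} → D ∈ F → ∣ D ∣ < lo ⊎ n ∸ lo < ∣ D ∣) → length F * t ≤ suc n * M
  tail-≤ {lo} {t} 2lo≤n tw≤ F F! extreme = begin
    length F * t
      ≤⟨ *-monoˡ-≤ t (length-by-levels ∣_∣ tails F size∈tails) ⟩
    ∑ tails (λ i → length (level ∣_∣ i F)) * t
      ≡⟨ ∑-*ʳ tails t (λ i → length (level ∣_∣ i F)) ⟨
    ∑ tails (λ i → length (level ∣_∣ i F) * t)
      ≤⟨ ∑-mono tails level-bound ⟩
    ∑ tails (λ _ → M)
      ≡⟨ ∑-const tails M ⟩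
    length tails * M
      ≤⟨ *-monoˡ-≤ M (≤-trans (length-filter tail? (upTo (suc n))) (≤-reflexive (length-upTo (suc n)))) ⟩
    suc n * M ∎
    where
    open ≤-Reasoning
    tail? : Decidable (λ i → i < lo ⊎ n ∸ lo < i)
    tail? i = (i <? lo) ⊎-dec (n ∸ lo <? i)
    tails = filter tail? (upTo (suc n))
    size∈tails : ∀ {D} → D ∈ F → ∣ D ∣ ∈ tails
    size∈tails {D} D∈ = ∈-filter⁺ tail? (∈-upTo⁺ (s≤s (∣p∣≤n D))) (extreme D∈)
    lo≤n : lo ≤ n
    lo≤n = ≤-trans (m≤m+n lo lo) 2lo≤n
    lo≤n∸lo : lo ≤ n ∸ lo
    lo≤n∸lo = ≤-trans (≤-reflexive (sym (m+n∸n≡m lo lo))) (∸-monoˡ-≤ lo 2lo≤n)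
    far : ∀ {i} → i ≤ n → i < lo ⊎ n ∸ lo < i → weight n lo ≤ weight n i
    far {i} i≤n (inj₁ i<lo) = !*!-spread (trans (m+[n∸m]≡n i≤n) (sym (m+[n∸m]≡n lo≤n))) (<⇒≤ i<lo) (≤-trans (<⇒≤ i<lo) lo≤n∸lo)
    far {i} i≤n (inj₂ hi<i) = ≤-trans
      (!*!-spread {n ∸ i} (trans (m∸n+n≡m i≤n) (sym (m+[n∸m]≡n lo≤n))) n∸i≤lo (≤-trans n∸i≤lo lo≤n∸lo))
      (≤-reflexive (*-comm ((n ∸ i) !) (i !)))
      where
      n∸i≤lo : n ∸ i ≤ lo
      n∸i≤lo = ≤-trans (∸-monoʳ-≤ n (<⇒≤ hi<i)) (≤-reflexive (m∸[m∸n]≡n lo≤n))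
    level-bound : ∀ {i} → i ∈ tails → length (level ∣_∣ i F) * t ≤ M
    level-bound {i} i∈ with ∈-filter⁻ tail? {xs = upTo (suc n)} i∈
    ... | i∈upTo , extr = *-cancelʳ-≤ _ _ (weight n p) (begin
      length (level ∣_∣ i F) * t * weight n p     ≡⟨ *-assoc (length (level ∣_∣ i F)) t (weight n p) ⟩
      length (level ∣_∣ i F) * (t * weight n p)   ≤⟨ *-monoʳ-≤ (length (level ∣_∣ i F)) (≤-trans tw≤ (far (≤-pred (∈-upTo⁻ i∈upTo)) extr)) ⟩
      length (level ∣_∣ i F) * weight n i         ≤⟨ lubell-level F F! i ⟩
      n !                                         ≡⟨ M*weight ⟨
      M * weight n p                              ∎)
      where instance _ = p !* (n ∸ p) !≢0

-- Logarithms, powers and the width of the window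

module _ (v r lo p : ℕ) (lo+r≤p : lo + r ≤ p) (lo+r≤v*r : lo + r ≤ v * r) where

  -- Each step contributes the factor (p + x + 1) / (lo + x + 1). Its numerator exceeds the
  -- denominator by at least `r`, and the denominator is at most `v * r`, so the factor is at least
  -- 1 + 1/v.
  factorial-ratio : ∀ x → x ≤ r → suc v ^ x * ((lo + x) ! * p !) ≤ v ^ x * (lo ! * (p + x) !)
  factorial-ratio zero    _   rewrite +-identityʳ lo | +-identityʳ p = ≤-refl
  factorial-ratio (suc x) x<r rewrite +-suc lo x | +-suc p x = begin
    suc v * suc v ^ x * (suc (lo + x) * (lo + x) ! * p !)
      ≡⟨ regroup (suc v) (suc v ^ x) (suc (lo + x)) ((lo + x) !) (p !) ⟩
    suc v * suc (lo + x) * (suc v ^ x * ((lo + x) ! * p !))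
      ≤⟨ *-mono-≤ factor (factorial-ratio x (<⇒≤ x<r)) ⟩
    v * suc (p + x) * (v ^ x * (lo ! * (p + x) !))
      ≡⟨ regroup′ v (v ^ x) (suc (p + x)) (lo !) ((p + x) !) ⟩
    v * v ^ x * (lo ! * (suc (p + x) * (p + x) !)) ∎
    where
    open ≤-Reasoning
    regroup : ∀ a b c d e → a * b * (c * d * e) ≡ a * c * (b * (d * e))
    regroup = solve-∀
    regroup′ : ∀ a b c d e → a * c * (b * (d * e)) ≡ a * b * (d * (c * e))
    regroup′ = solve-∀
    factor : suc v * suc (lo + x) ≤ v * suc (p + x)
    factor = begin
      suc (lo + x) + v * suc (lo + x)   ≤⟨ +-monoˡ-≤ (v * suc (lo + x)) (≤-trans (≤-reflexive (sym (+-suc lo x))) (≤-trans (+-monoʳ-≤ lo x<r) lo+r≤v*r)) ⟩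
      v * r + v * suc (lo + x)          ≡⟨ *-distribˡ-+ v r (suc (lo + x)) ⟨
      v * (r + suc (lo + x))            ≡⟨ cong (v *_) (shuffle r lo x) ⟩
      v * suc (lo + r + x)              ≤⟨ *-monoʳ-≤ v (s≤s (+-monoˡ-≤ x lo+r≤p)) ⟩
      v * suc (p + x)                   ∎
      where
      shuffle : ∀ r l x → r + suc (l + x) ≡ suc (l + r + x)
      shuffle = solve-∀

-- Bernoulli's inequality for (1 + 1/v)^m with denominators cleared; `m = v` gives (1 + 1/v)^v ≥ 2.
bernoulli : ∀ v m → v ^ m * (v + m) ≤ v * suc v ^ m
bernoulli v zero    = ≤-reflexive (base v)
  where
  base : ∀ v → 1 * (v + 0) ≡ v * 1
  base = solve-∀
bernoulli v (suc m) = begin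
  v * v ^ m * (v + suc m)                  ≤⟨ m≤m+n _ (v ^ m * m) ⟩
  v * v ^ m * (v + suc m) + v ^ m * m      ≡⟨ factor v m (v ^ m) ⟩
  suc v * (v ^ m * (v + m))                ≤⟨ *-monoʳ-≤ (suc v) (bernoulli v m) ⟩
  suc v * (v * suc v ^ m)                  ≡⟨ *-swap (suc v) v (suc v ^ m) ⟩
  v * (suc v * suc v ^ m)                  ∎
  where
  open ≤-Reasoning
  factor : ∀ v m x → v * x * (v + suc m) + x * m ≡ suc v * (x * (v + m))
  factor = solve-∀

^-distrib-* : ∀ k m n → (m * n) ^ k ≡ m ^ k * n ^ k
^-distrib-* zero    m n = refl
^-distrib-* (suc k) m n = trans (cong (m * n *_) (^-distrib-* k m n)) (*-interchange m n (m ^ k) (n ^ k))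

2^*v^-≤ : ∀ v c → .{{_ : NonZero v}} → 2 ^ c * v ^ (v * c) ≤ suc v ^ (v * c)
2^*v^-≤ v c = begin
  2 ^ c * v ^ (v * c)      ≡⟨ cong (2 ^ c *_) (^-*-assoc v v c) ⟨
  2 ^ c * (v ^ v) ^ c      ≡⟨ ^-distrib-* c 2 (v ^ v) ⟨
  (2 * v ^ v) ^ c          ≤⟨ ^-monoˡ-≤ c doubling ⟩
  (suc v ^ v) ^ c          ≡⟨ ^-*-assoc (suc v) v c ⟩
  suc v ^ (v * c)          ∎
  where
  open ≤-Reasoning
  doubling : 2 * v ^ v ≤ suc v ^ v
  doubling = *-cancelˡ-≤ v (≤-trans (≤-reflexive (double v (v ^ v))) (bernoulli v v))
    where
    double : ∀ v x → v * (2 * x) ≡ x * (v + v)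
    double = solve-∀

n<2^[1+log₂n] : ∀ n → n < 2 ^ suc ⌊log₂ n ⌋
n<2^[1+log₂n] n = ≰⇒> λ 2^≤n → 1+n≰n (≤-trans (≤-reflexive (sym (⌊log₂[2^n]⌋≡n (suc ⌊log₂ n ⌋)))) (⌊log₂⌋-mono-≤ 2^≤n))

2^log₂n≤n : ∀ n → 1 ≤ n → 2 ^ ⌊log₂ n ⌋ ≤ n
2^log₂n≤n = <-rec _ step′
  where
  step′ : ∀ n → (∀ {m} → m < n → 1 ≤ m → 2 ^ ⌊log₂ m ⌋ ≤ m) → 1 ≤ n → 2 ^ ⌊log₂ n ⌋ ≤ n
  step′ (suc zero)        rec _ = ≤-refl
  step′ n@(suc (suc n-2)) rec _ = begin
    2 ^ ⌊log₂ n ⌋                   ≡⟨ cong (2 ^_) log≡ ⟩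
    2 * 2 ^ ⌊log₂ ⌊ n /2⌋ ⌋         ≤⟨ *-monoʳ-≤ 2 (rec (⌊n/2⌋<n (suc n-2)) (s≤s z≤n)) ⟩
    2 * ⌊ n /2⌋                     ≡⟨ cong (⌊ n /2⌋ +_) (+-identityʳ _) ⟩
    ⌊ n /2⌋ + ⌊ n /2⌋               ≤⟨ +-monoʳ-≤ ⌊ n /2⌋ (⌊n/2⌋≤⌈n/2⌉ n) ⟩
    ⌊ n /2⌋ + ℕ.⌈ n /2⌉              ≡⟨ ⌊n/2⌋+⌈n/2⌉≡n n ⟩
    n                               ∎
    where
    open ≤-Reasoning
    1≤log : 1 ≤ ⌊log₂ n ⌋
    1≤log = ⌊log₂⌋-mono-≤ {2} {n} (s≤s (s≤s z≤n))
    log≡ : ⌊log₂ n ⌋ ≡ suc ⌊log₂ ⌊ n /2⌋ ⌋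
    log≡ = trans (sym (m+[n∸m]≡n 1≤log)) (cong suc (sym (⌊log₂⌊n/2⌋⌋≡⌊log₂n⌋∸1 n)))

n²≤2*2^n : ∀ n → n * n ≤ 2 * 2 ^ n
n²≤2*2^n 0 = z≤n
n²≤2*2^n 1 = s≤s z≤n
n²≤2*2^n 2 = m≤m+n 4 4
n²≤2*2^n 3 = m≤m+n 9 7
n²≤2*2^n (suc n@(suc (suc (suc k)))) = begin
  suc n * suc n            ≤⟨ m≤m+n _ (2 + 4 * k + k * k) ⟩
  suc n * suc n + (2 + 4 * k + k * k) ≡⟨ square k ⟩
  2 * (n * n)              ≤⟨ *-monoʳ-≤ 2 (n²≤2*2^n n) ⟩
  2 * (2 * 2 ^ n)          ∎
  where
  open ≤-Reasoning
  square : ∀ k → (4 + k) * (4 + k) + (2 + 4 * k + k * k) ≡ 2 * ((3 + k) * (3 + k))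
  square = solve-∀

-- If the logarithm L is at least 2c, then 2cL ≤ L² ≤ 2 · 2^L ≤ 2n; otherwise cL ≤ 2c² ≤ n.
log₂-sublinear : ∀ c n → 1 ≤ n → 2 * (c * c) ≤ n → c * ⌊log₂ n ⌋ ≤ n
log₂-sublinear c n 1≤n 2cc≤n with ≤-total (2 * c) ⌊log₂ n ⌋
... | inj₁ 2c≤L = *-cancelˡ-≤ 2 (begin
  2 * (c * L)        ≡⟨ *-assoc 2 c L ⟨
  2 * c * L          ≤⟨ *-monoˡ-≤ L 2c≤L ⟩
  L * L              ≤⟨ n²≤2*2^n L ⟩
  2 * 2 ^ L          ≤⟨ *-monoʳ-≤ 2 (2^log₂n≤n n 1≤n) ⟩
  2 * n              ∎)
  where
  open ≤-Reasoning
  L = ⌊log₂ n ⌋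
... | inj₂ L≤2c = begin
  c * ⌊log₂ n ⌋      ≤⟨ *-monoʳ-≤ c L≤2c ⟩
  c * (2 * c)        ≡⟨ *-swap c 2 c ⟩
  2 * (c * c)        ≤⟨ 2cc≤n ⟩
  n                  ∎
  where
  open ≤-Reasoning

-- An integer substitute for √(n / c), found by raising `v` only when the lower bound fails; the
-- factor 4 comes from (v + 1)² ≤ 4v² + 1.
scaled-root : ∀ c → 1 ≤ c → ∀ n → ∃ λ v → n ≤ c * (v * v) × c * (v * v) ≤ 4 * n + c
scaled-root c 1≤c zero = 0 , z≤n , ≤-trans (≤-reflexive (*-zeroʳ c)) z≤n
scaled-root c 1≤c (suc n) with scaled-root c 1≤c n
... | v , n≤ , ≤4n with suc n ≤? c * (v * v)
...   | yes 1+n≤ = v , 1+n≤ , ≤-trans ≤4n (+-monoˡ-≤ c (*-monoʳ-≤ 4 (n≤1+n n)))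
...   | no  1+n≰ = suc v , lower , upper
  where
  open ≤-Reasoning
  lower : suc n ≤ c * (suc v * suc v)
  lower = begin
    1 + n                          ≤⟨ +-mono-≤ 1≤c n≤ ⟩
    c + c * (v * v)                ≤⟨ m≤m+n _ (c * (2 * v)) ⟩
    c + c * (v * v) + c * (2 * v)  ≡⟨ expand c v ⟩
    c * (suc v * suc v)            ∎
    where
    expand : ∀ c v → c + c * (v * v) + c * (2 * v) ≡ c * (suc v * suc v)
    expand = solve-∀
  v≤v² : ∀ v → v ≤ v * v
  v≤v² zero    = z≤n
  v≤v² (suc v) = m≤m*n (suc v) (suc v)
  upper : c * (suc v * suc v) ≤ 4 * suc n + c
  upper = begin
    c * (suc v * suc v)              ≡⟨ expand c v ⟩
    c * (v * v) + 2 * c * v + c      ≤⟨ +-monoˡ-≤ c (+-monoʳ-≤ (c * (v * v)) (*-monoʳ-≤ (2 * c) (v≤v² v))) ⟩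
    c * (v * v) + 2 * c * (v * v) + c ≤⟨ +-monoˡ-≤ c (m≤m+n _ (c * (v * v))) ⟩
    c * (v * v) + 2 * c * (v * v) + c * (v * v) + c ≡⟨ collect c v ⟩
    4 * (c * (v * v)) + c            ≤⟨ +-monoˡ-≤ c (*-monoʳ-≤ 4 (≤-trans (≤-pred (≰⇒> 1+n≰)) (n≤1+n n))) ⟩
    4 * suc n + c                    ∎
    where
    expand : ∀ c v → c * (suc v * suc v) ≡ c * (v * v) + 2 * c * v + c
    expand = solve-∀
    collect : ∀ c v → c * (v * v) + 2 * c * (v * v) + c * (v * v) + c ≡ 4 * (c * (v * v)) + c
    collect = solve-∀

-- Rounding and the limits of the middle sum

half-bounds : ∀ m → m ≤ 2 * ((m + 1) / 2) × 2 * ((m + 1) / 2) ≤ m + 1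
half-bounds m = lower , ≤-trans (≤-reflexive (*-comm 2 l)) (m/n*n≤m (m + 1) 2)
  where
  open ≤-Reasoning
  l = (m + 1) / 2
  lower : m ≤ 2 * l
  lower = +-cancelʳ-≤ 1 m (2 * l) (begin
    m + 1                    ≡⟨ m≡m%n+[m/n]*n (m + 1) 2 ⟩
    (m + 1) % 2 + l * 2      ≤⟨ +-monoˡ-≤ (l * 2) (≤-pred (m%n<n (m + 1) 2)) ⟩
    1 + l * 2                ≡⟨ flip l ⟩
    2 * l + 1                ∎)
    where
    flip : ∀ l → 1 + l * 2 ≡ 2 * l + 1
    flip = solve-∀

[x+κ*2]/2 : ∀ x κ → (x + κ * 2) / 2 ≡ x / 2 + κ
[x+κ*2]/2 x κ = trans (+-distrib-/-∣ʳ x (divides-refl κ)) (cong (x / 2 +_) (m*n/n≡m κ 2))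

-- For `h = 1 + κ` this evaluates both the upper limit of `Σbin n κ` and the level ⌊(n + h)/2⌋ of
-- the error term.
[n+κ+1]/2 : ∀ {n} κ m → n ≡ κ + m → (n + (1 + κ)) / 2 ≡ (m + 1) / 2 + κ
[n+κ+1]/2 κ m refl = trans (cong (_/ 2) (regroup κ m)) ([x+κ*2]/2 (m + 1) κ)
  where
  regroup : ∀ κ m → κ + m + (1 + κ) ≡ m + 1 + κ * 2
  regroup = solve-∀

Σbin-middle : ∀ {n} κ m → n ≡ κ + m → Σbin n κ ≡ ∑ (upTo κ) (λ j → n C ((m + 1) / 2 + j))
Σbin-middle κ m refl
  rewrite m+n∸m≡n κ m | +-assoc (κ + m) κ 1 | +-comm κ 1 | [n+κ+1]/2 κ m refl | m+n∸m≡n ((m + 1) / 2) κ = refl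

Config-⊆ : ∀ {n s t h} {F G : List (Subset n)} → (∀ {D} → D ∈ G → D ∈ F) → Config n s t h G → Config n s t h F
Config-⊆ G⊆F config = record
  { A = K.A ; B = K.B ; C = K.C
  ; A∈F = G⊆F ∘ K.A∈F ; B∈F = G⊆F ∘ K.B∈F ; C∈F = G⊆F ∘ K.C∈F
  ; A-inj = K.A-inj ; B-inj = K.B-inj ; C-inj = K.C-inj
  ; A≢B = K.A≢B ; A≢C = K.A≢C ; B≢C = K.B≢C
  ; A⊆B = K.A⊆B ; B-chain = K.B-chain ; B⊆C = K.B⊆C
  ; A-size = K.A-size ; C-size = K.C-size
  }
  where module K = Config config

m²≤n²⇒m≤n : ∀ {m n} → m * m ≤ n * n → m ≤ n
m²≤n²⇒m≤n m²≤n² = ≮⇒≥ (λ n<m → <⇒≱ (*-mono-< n<m n<m) m²≤n²)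

-- The radius of the window

module Radius (g L n v : ℕ) (1≤g : 1 ≤ g) (1≤L : 1 ≤ L) (large : 30 * (g * g) * L ≤ n)
              (v-upper : 3 * (1 + L) * (v * v) ≤ 4 * n + 3 * (1 + L)) where

  open ≤-Reasoning

  c r : ℕ
  c = 3 * (1 + L)
  r = v * c

  c≤6L : c ≤ 6 * L
  c≤6L = ≤-trans (*-monoʳ-≤ 3 (+-monoˡ-≤ L 1≤L)) (≤-reflexive (six L))
    where
    six : ∀ L → 3 * (L + L) ≡ 6 * L
    six = solve-∀

  30L≤n : 30 * L ≤ n
  30L≤n = ≤-trans (*-monoˡ-≤ L (*-monoʳ-≤ 30 (*-mono-≤ 1≤g 1≤g))) large

  -- The 30 is 6 · 5, from `c ≤ 6 * L` and c v² ≤ 4n + c ≤ 5n. Hence `r` is of order √(n log n).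
  r²≤ : r * r ≤ 30 * L * n
  r²≤ = begin
    r * r                 ≡⟨ square v c ⟩
    c * (c * (v * v))     ≤⟨ *-mono-≤ c≤6L v-upper ⟩
    6 * L * (4 * n + c)   ≤⟨ *-monoʳ-≤ (6 * L) (+-monoʳ-≤ (4 * n) (≤-trans c≤6L (≤-trans (*-monoˡ-≤ L (m≤m+n 6 24)) 30L≤n))) ⟩
    6 * L * (4 * n + n)   ≡⟨ collect L n ⟩
    30 * L * n            ∎
    where
    square : ∀ v c → v * c * (v * c) ≡ c * (c * (v * v))
    square = solve-∀
    collect : ∀ L n → 6 * L * (4 * n + n) ≡ 30 * L * n
    collect = solve-∀

  g*r≤n : g * r ≤ n
  g*r≤n = m²≤n²⇒m≤n (begin
    g * r * (g * r)         ≡⟨ square g r ⟩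
    g * g * (r * r)         ≤⟨ *-monoʳ-≤ (g * g) r²≤ ⟩
    g * g * (30 * L * n)    ≡⟨ regroup (g * g) L n ⟩
    30 * (g * g) * L * n    ≤⟨ *-monoˡ-≤ n large ⟩
    n * n                   ∎)
    where
    square : ∀ g r → g * r * (g * r) ≡ g * g * (r * r)
    square = solve-∀
    regroup : ∀ g L n → g * (30 * L * n) ≡ 30 * g * L * n
    regroup = solve-∀

-- The bound for a single `n`

module Bound (a b k m n L v : ℕ) (n≡κ+m : n ≡ 2 + k + m) (1≤v : 1 ≤ v)
             (n<2^ : n < 2 ^ (1 + L)) (v-lower : n ≤ 3 * (1 + L) * (v * v))
             (radius : 36 * (5 + k) * (v * (3 * (1 + L))) ≤ n) (6a≤n : 6 * a ≤ n) (6b≤n : 6 * b ≤ n) where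

  open ≤-Reasoning

  κ c r ρ l q lo error : ℕ
  κ  = 2 + k
  -- Chosen so that `2 ^ c` is at least n³.
  c  = 3 * (1 + L)
  r  = v * c
  -- The window reaches from `q - r` to `p + r`, and `p - q` is at most `1 + κ`.
  ρ  = 2 * r + (1 + κ)
  l  = (m + 1) / 2
  q  = m ∸ l
  lo = q ∸ r
  error = lightError a + lightError b

  instance
    v≢0 : NonZero v
    v≢0 = >-nonZero 1≤v

  1≤r : 1 ≤ r
  1≤r = *-mono-≤ 1≤v (s≤s z≤n)

  ρ≤ : ρ ≤ (5 + k) * r
  ρ≤ = begin
    2 * r + (1 + κ)          ≡⟨ cong (2 * r +_) (sym (*-identityʳ (1 + κ))) ⟩
    2 * r + (1 + κ) * 1      ≤⟨ +-monoʳ-≤ (2 * r) (*-monoʳ-≤ (1 + κ) 1≤r) ⟩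
    2 * r + (1 + κ) * r      ≡⟨ *-distribʳ-+ r 2 (1 + κ) ⟨
    (5 + k) * r              ∎

  36ρ≤n : 36 * ρ ≤ n
  36ρ≤n = ≤-trans (*-monoʳ-≤ 36 ρ≤) (≤-trans (≤-reflexive (sym (*-assoc 36 (5 + k) r))) radius)

  1≤ρ : 1 ≤ ρ
  1≤ρ = ≤-trans (s≤s z≤n) (m≤n+m (1 + κ) (2 * r))

  36≤n : 36 ≤ n
  36≤n = ≤-trans (*-monoʳ-≤ 36 1≤ρ) 36ρ≤n

  instance
    n≢0 : NonZero n
    n≢0 = >-nonZero (≤-trans (s≤s z≤n) 36≤n)

  m≤2l : m ≤ 2 * l
  m≤2l = proj₁ (half-bounds m)

  2l≤1+m : 2 * l ≤ 1 + m
  2l≤1+m = ≤-trans (proj₂ (half-bounds m)) (≤-reflexive (+-comm m 1))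

  l+l≡2l : l + l ≡ 2 * l
  l+l≡2l = cong (l +_) (sym (+-identityʳ l))

  l≤m : l ≤ m
  l≤m = helper l 2l≤1+m
    where
    helper : ∀ l → 2 * l ≤ 1 + m → l ≤ m
    helper zero    _   = z≤n
    helper (suc l) 2l≤ = ≤-trans (m≤n+m (suc l) l) (≤-pred (≤-trans (≤-reflexive (cong (λ x → suc (l + x)) (sym (+-identityʳ (suc l))))) 2l≤))

  q+l≡m : q + l ≡ m
  q+l≡m = m∸n+n≡m l≤m

  q≤l : q ≤ l
  q≤l = +-cancelʳ-≤ l q l (≤-trans (≤-reflexive q+l≡m) (≤-trans m≤2l (≤-reflexive (sym l+l≡2l))))

  l≤1+q : l ≤ 1 + q
  l≤1+q = +-cancelʳ-≤ l l (1 + q) (≤-trans (≤-reflexive l+l≡2l) (≤-trans 2l≤1+m (≤-reflexive (cong suc (sym q+l≡m)))))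

  n≡κ+[q+l] : n ≡ κ + (q + l)
  n≡κ+[q+l] = trans n≡κ+m (cong (κ +_) (sym q+l≡m))

  open Middle κ l q n≡κ+[q+l] q≤l l≤1+q

  n≤κ+1+2q : n ≤ 1 + κ + 2 * q
  n≤κ+1+2q = begin
    n                    ≡⟨ n≡κ+[q+l] ⟩
    κ + (q + l)          ≤⟨ +-monoʳ-≤ κ (+-monoʳ-≤ q l≤1+q) ⟩
    κ + (q + (1 + q))    ≡⟨ regroup κ q ⟩
    1 + κ + 2 * q        ∎
    where
    regroup : ∀ κ q → κ + (q + (1 + q)) ≡ 1 + κ + 2 * q
    regroup = solve-∀

  r≤q : r ≤ q
  r≤q = *-cancelˡ-≤ 2 (+-cancelˡ-≤ (1 + κ) (2 * r) (2 * q) (begin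
    1 + κ + 2 * r     ≡⟨ +-comm (1 + κ) (2 * r) ⟩
    ρ                 ≤⟨ m≤m+n ρ (35 * ρ) ⟩
    36 * ρ            ≤⟨ 36ρ≤n ⟩
    n                 ≤⟨ n≤κ+1+2q ⟩
    1 + κ + 2 * q     ∎))

  lo+r≡q : lo + r ≡ q
  lo+r≡q = m∸n+n≡m r≤q

  n≤2lo+ρ : n ≤ 2 * lo + ρ
  n≤2lo+ρ = begin
    n                           ≤⟨ n≤κ+1+2q ⟩
    1 + κ + 2 * q               ≡⟨ cong (λ x → 1 + κ + 2 * x) lo+r≡q ⟨
    1 + κ + 2 * (lo + r)        ≡⟨ regroup (1 + κ) lo r ⟩
    2 * lo + (2 * r + (1 + κ))  ∎
    where
    regroup : ∀ x lo r → x + 2 * (lo + r) ≡ 2 * lo + (2 * r + x)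
    regroup = solve-∀

  n+4≤4lo : n + 4 ≤ 4 * lo
  n+4≤4lo = +-cancelʳ-≤ (2 * ρ) (n + 4) (4 * lo) (begin
    n + 4 + 2 * ρ           ≡⟨ +-assoc n 4 (2 * ρ) ⟩
    n + (4 + 2 * ρ)         ≤⟨ +-monoʳ-≤ n (≤-trans (+-monoˡ-≤ (2 * ρ) (≤-trans (m≤m+n 4 30) (*-monoʳ-≤ 34 1≤ρ)))
                                 (≤-trans (≤-reflexive (sym (*-distribʳ-+ ρ 34 2))) 36ρ≤n)) ⟩
    n + n                   ≤⟨ +-mono-≤ n≤2lo+ρ n≤2lo+ρ ⟩
    2 * lo + ρ + (2 * lo + ρ) ≡⟨ double lo ρ ⟩
    4 * lo + 2 * ρ          ∎)
    where
    double : ∀ lo ρ → 2 * lo + ρ + (2 * lo + ρ) ≡ 4 * lo + 2 * ρ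
    double = solve-∀

  2≤lo : 2 ≤ lo
  2≤lo = *-cancelˡ-≤ 4 (≤-trans (≤-trans (m≤m+n 8 28) 36≤n) (≤-trans (m≤m+n n 4) n+4≤4lo))

  lo≤q : lo ≤ q
  lo≤q = m∸n≤m q r

  lo+lo≤n : lo + lo ≤ n
  lo+lo≤n = ≤-trans (+-mono-≤ lo≤q (≤-trans lo≤q q≤l)) (≤-trans (m≤n+m (q + l) κ) (≤-reflexive (sym n≡κ+[q+l])))

  n∸lo≡p+r : n ∸ lo ≡ p + r
  n∸lo≡p+r = trans (cong (_∸ lo) (sym (trans (regroup lo p r) (trans (cong (_+ p) lo+r≡q) q+p≡n)))) (m+n∸m≡n lo (p + r))
    where
    regroup : ∀ lo p r → lo + (p + r) ≡ lo + r + p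
    regroup = solve-∀

  -- (p + y) / (lo + y) ≥ 1 + 1/v for y ≤ r, and (1 + 1/v)^v ≥ 2, so the quotient of the two weights is at
  -- least (1 + 1/v)^r ≥ 2^c ≥ n³.
  tail-ratio : n ^ 3 * weight n p ≤ weight n lo
  tail-ratio = *-cancelˡ-≤ (v ^ r) {{m^n≢0 v r}} (begin
    v ^ r * (n ^ 3 * weight n p)
      ≤⟨ *-monoʳ-≤ (v ^ r) (*-monoˡ-≤ (weight n p) n³≤2^c) ⟩
    v ^ r * (2 ^ c * weight n p)
      ≡⟨ regroup (v ^ r) (2 ^ c) (weight n p) ⟩
    2 ^ c * v ^ r * weight n p
      ≤⟨ *-monoˡ-≤ (weight n p) (2^*v^-≤ v c) ⟩
    suc v ^ r * weight n p
      ≡⟨ cong (suc v ^ r *_) (trans weight-p (cong (λ x → x ! * p !) (sym lo+r≡q))) ⟩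
    suc v ^ r * ((lo + r) ! * p !)
      ≤⟨ factorial-ratio v r lo p (≤-trans (≤-reflexive lo+r≡q) q≤p) (≤-trans (≤-reflexive lo+r≡q) q≤v*r) r ≤-refl ⟩
    v ^ r * (lo ! * (p + r) !)
      ≡⟨ cong (λ x → v ^ r * (lo ! * x !)) (sym n∸lo≡p+r) ⟩
    v ^ r * weight n lo ∎)
    where
    regroup : ∀ x y z → x * (y * z) ≡ y * x * z
    regroup = solve-∀
    n³≤2^c : n ^ 3 ≤ 2 ^ c
    n³≤2^c = begin
      n ^ 3                    ≤⟨ ^-monoˡ-≤ 3 (<⇒≤ n<2^) ⟩
      (2 ^ (1 + L)) ^ 3        ≡⟨ ^-*-assoc 2 (1 + L) 3 ⟩
      2 ^ ((1 + L) * 3)        ≡⟨ cong (2 ^_) (*-comm (1 + L) 3) ⟩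
      2 ^ c                    ∎
    q≤v*r : q ≤ v * r
    q≤v*r = begin
      q               ≤⟨ m≤m+n q p ⟩
      q + p           ≡⟨ q+p≡n ⟩
      n               ≤⟨ v-lower ⟩
      c * (v * v)     ≡⟨ rotate c v ⟩
      v * (v * c)     ∎
      where
      rotate : ∀ c v → c * (v * v) ≡ v * (v * c)
      rotate = solve-∀

  middleSum : ℕ
  middleSum = ∑ (upTo κ) (λ j → n C (l + j))

  module _ (F : List (Subset n)) (F! : Unique F) (no-config : ¬ Config n (1 + a) (1 + b) (3 + k) F) where

    Central : Pred (Subset n) _
    Central D = lo ≤ ∣ D ∣ × ∣ D ∣ ≤ n ∸ lo

    central? : Decidable Central
    central? D = (lo ≤? ∣ D ∣) ×-dec (∣ D ∣ ≤? n ∸ lo)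

    Fc Ft : List (Subset n)
    Fc = filter central? F
    Ft = filter (U.∁? central?) F

    -- The `κ` whole units in `lubell-≤` cancel against the term `κ * (M * n !)` of
    -- `length-≤-lubell`, leaving only the small terms.
    central-≤ : n * n * length Fc ≤ n * n * middleSum + M * (2 * (a + b) * n + error * ρ)
    central-≤ = *-cancelʳ-≤ _ _ (n !) {{n !≢0}} (+-cancelʳ-≤ (κ * (M * n !) * (n * n)) _ _ (begin
      n * n * length Fc * n ! + κ * (M * n !) * (n * n)
        ≡⟨ factor (n * n) (length Fc) (n !) (κ * (M * n !)) ⟩
      n * n * (length Fc * n ! + κ * (M * n !))
        ≤⟨ *-monoʳ-≤ (n * n) (length-≤-lubell Fc Fc!) ⟩
      n * n * (n ! * middleSum + M * lubell Fc)
        ≡⟨ distribute (n * n) (n !) middleSum M (lubell Fc) ⟩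
      n * n * middleSum * n ! + M * (n * n * lubell Fc)
        ≤⟨ +-monoʳ-≤ (n * n * middleSum * n !) (*-monoʳ-≤ M
             (lubell-≤ lo ρ n+4≤4lo 2≤lo n≤2lo+ρ 36ρ≤n 1≤ρ Fc Fc! (proj₁ ∘ central) (proj₂ ∘ central) {a} {b} {k} 6a≤n 6b≤n
                (no-config ∘ Config-⊆ (proj₁ ∘ ∈-filter⁻ central?)))) ⟩
      n * n * middleSum * n ! + M * (n ! * (κ * (n * n) + 2 * (a + b) * n + error * ρ))
        ≡⟨ collect (n * n) middleSum (n !) M κ (2 * (a + b) * n) (error * ρ) ⟩
      (n * n * middleSum + M * (2 * (a + b) * n + error * ρ)) * n ! + κ * (M * n !) * (n * n) ∎))
      where
      Fc! : Unique Fc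
      Fc! = Unique.filter⁺ central? F!
      central : ∀ {D} → D ∈ Fc → Central D
      central = proj₂ ∘ ∈-filter⁻ central? {xs = F}
      factor : ∀ x y z w → x * y * z + w * x ≡ x * (y * z + w)
      factor = solve-∀
      distribute : ∀ x N S M W → x * (N * S + M * W) ≡ x * S * N + M * (x * W)
      distribute = solve-∀
      collect : ∀ x S N M κ y z → x * S * N + M * (N * (κ * x + y + z)) ≡ (x * S + M * (y + z)) * N + κ * (M * N) * x
      collect = solve-∀

    -- The tail has at most (n + 1) M / n³ members; a factor `ρ ≥ 1` is inserted so that it merges
    -- with the error term.
    extreme-≤ : n * n * length Ft ≤ 2 * ρ * M
    extreme-≤ = *-cancelʳ-≤ _ _ n (begin
      n * n * length Ft * n   ≡⟨ cube n (length Ft) ⟩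
      length Ft * n ^ 3       ≤⟨ tail-≤ {lo} {n ^ 3} lo+lo≤n tail-ratio Ft (Unique.filter⁺ (U.∁? central?) F!) extreme ⟩
      suc n * M               ≤⟨ *-monoˡ-≤ M (+-monoˡ-≤ n (≤-trans (s≤s z≤n) 36≤n)) ⟩
      (n + n) * M             ≡⟨ double n M ⟩
      2 * 1 * M * n           ≤⟨ *-monoˡ-≤ n (*-monoˡ-≤ M (*-monoʳ-≤ 2 1≤ρ)) ⟩
      2 * ρ * M * n           ∎)
      where
      cube : ∀ n x → n * n * x * n ≡ x * (n * (n * (n * 1)))
      cube = solve-∀
      double : ∀ n M → (n + n) * M ≡ 2 * 1 * M * n
      double = solve-∀
      extreme : ∀ {D} → D ∈ Ft → ∣ D ∣ < lo ⊎ n ∸ lo < ∣ D ∣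
      extreme {D} D∈ with lo ≤? ∣ D ∣
      ... | no  lo≰ = inj₁ (≰⇒> lo≰)
      ... | yes lo≤ = inj₂ (≰⇒> (λ ≤hi → proj₂ (∈-filter⁻ (U.∁? central?) {xs = F} D∈) (lo≤ , ≤hi)))

    size-≤ : n * (n * length F ∸ (n * middleSum + 2 * (a + b) * M)) ≤ (2 + error) * ρ * M
    size-≤ = begin
      n * (n * length F ∸ (n * middleSum + 2 * (a + b) * M))
        ≡⟨ *-distribˡ-∸ n (n * length F) (n * middleSum + 2 * (a + b) * M) ⟩
      n * (n * length F) ∸ n * (n * middleSum + 2 * (a + b) * M)
        ≤⟨ m≤n+o⇒m∸n≤o _ (n * (n * middleSum + 2 * (a + b) * M)) total ⟩
      (2 + error) * ρ * M ∎
      where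
      split : ∀ n x y → n * (n * (x + y)) ≡ n * n * x + n * n * y
      split = solve-∀
      collect : ∀ n S M x e ρ → n * n * S + M * (2 * x * n + e * ρ) + 2 * ρ * M ≡ n * (n * S + 2 * x * M) + (2 + e) * ρ * M
      collect = solve-∀
      total : n * (n * length F) ≤ n * (n * middleSum + 2 * (a + b) * M) + (2 + error) * ρ * M
      total = begin
        n * (n * length F)                           ≡⟨ cong (λ x → n * (n * x)) (length-split central? F) ⟩
        n * (n * (length Fc + length Ft))            ≡⟨ split n (length Fc) (length Ft) ⟩
        n * n * length Fc + n * n * length Ft        ≤⟨ +-mono-≤ central-≤ extreme-≤ ⟩
        n * n * middleSum + M * (2 * (a + b) * n + error * ρ) + 2 * ρ * M ≡⟨ collect n middleSum M (a + b) error ρ ⟩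
        n * (n * middleSum + 2 * (a + b) * M) + (2 + error) * ρ * M       ∎

-- Squaring replaces the root of `L * n` by the bound on `r * r`. The 30 is raised to 36 = 6 · 6 so
-- that the constant is a perfect square.
square-bound : ∀ n D e ρ M H r L → .{{_ : NonZero n}} → n * D ≤ e * ρ * M → ρ ≤ H * r → r * r ≤ 30 * L * n →
               D * D * n ≤ 6 * (e * H) * (6 * (e * H)) * M * M * L
square-bound n D e ρ M H r L nD≤ ρ≤ r²≤ = *-cancelˡ-≤ n (begin
  n * (D * D * n)                             ≡⟨ square n D ⟩
  n * D * (n * D)                             ≤⟨ *-mono-≤ nD≤′ nD≤′ ⟩
  e * (H * r) * M * (e * (H * r) * M)         ≡⟨ expand e H r M ⟩
  e * H * (e * H) * (M * M) * (r * r)         ≤⟨ *-monoʳ-≤ (e * H * (e * H) * (M * M)) (≤-trans r²≤ (*-monoˡ-≤ n (*-monoˡ-≤ L (m≤m+n 30 6)))) ⟩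
  e * H * (e * H) * (M * M) * (36 * L * n)    ≡⟨ collect n (e * H) M L ⟩
  n * (6 * (e * H) * (6 * (e * H)) * M * M * L) ∎)
  where
  open ≤-Reasoning
  nD≤′ : n * D ≤ e * (H * r) * M
  nD≤′ = ≤-trans nD≤ (*-monoˡ-≤ M (*-monoʳ-≤ e ρ≤))
  square : ∀ n D → n * (D * D * n) ≡ n * D * (n * D)
  square = solve-∀
  expand : ∀ e H r M → e * (H * r) * M * (e * (H * r) * M) ≡ e * H * (e * H) * (M * M) * (r * r)
  expand = solve-∀
  collect : ∀ n x M L → x * x * (M * M) * (36 * L * n) ≡ n * (6 * x * (6 * x) * M * M * L)
  collect = solve-∀

-- Choice of the parameters for large `n`

module _ (a b k n g : ℕ) (g≡ : g ≡ 36 * (5 + k)) (2+k≤n : 2 + k ≤ n) (6[a+b]≤n : 6 * a + 6 * b ≤ n)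
         (large : 2 * (30 * (g * g) * (30 * (g * g))) ≤ n) where

  private
    L c : ℕ
    L  = ⌊log₂ n ⌋
    c  = 3 * (1 + L)

    2≤n : 2 ≤ n
    2≤n = ≤-trans (m≤m+n 2 k) 2+k≤n

    1≤g : 1 ≤ g
    1≤g = ≤-trans (s≤s z≤n) (≤-reflexive (sym g≡))

    1≤L : 1 ≤ L
    1≤L = ⌊log₂⌋-mono-≤ 2≤n

    root = scaled-root c (s≤s z≤n) n
    v = proj₁ root

    1≤v : 1 ≤ v
    1≤v with v in v≡ | proj₁ (proj₂ root)
    ... | suc _ | _    = s≤s z≤n
    ... | zero  | n≤c0 = contradiction (≤-trans 2≤n (≤-trans n≤c0 (≤-reflexive (*-zeroʳ c)))) λ ()

    m = proj₁ (m≤n⇒∃[o]m+o≡n 2+k≤n)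

    n≡κ+m : n ≡ 2 + k + m
    n≡κ+m = sym (proj₂ (m≤n⇒∃[o]m+o≡n 2+k≤n))

    instance
      n≢0 : NonZero n
      n≢0 = >-nonZero (≤-trans (s≤s z≤n) 2≤n)

  open Radius g L n v 1≤g 1≤L (log₂-sublinear (30 * (g * g)) n (≤-trans (s≤s z≤n) 2≤n) large) (proj₂ (proj₂ root))
    using (r; r²≤; g*r≤n)

  open Bound a b k m n L v n≡κ+m 1≤v (n<2^[1+log₂n] n) (proj₁ (proj₂ root))
         (subst (λ x → x * r ≤ n) g≡ g*r≤n)
         (≤-trans (m≤m+n _ (6 * b)) 6[a+b]≤n) (≤-trans (m≤n+m _ (6 * a)) 6[a+b]≤n)
       using (size-≤; ρ≤)

  deviation-≤ : (F : List (Subset n)) → Unique F → ¬ Config n (1 + a) (1 + b) (3 + k) F →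
    let M = n C ((n + (3 + k)) / 2)
        D = n * length F ∸ (n * Σbin n (2 + k) + 2 * (1 + a + (1 + b) ∸ 2) * M)
        K = 6 * ((2 + (lightError a + lightError b)) * (5 + k))
    in D * D * n ≤ K * K * M * M * L
  deviation-≤ F F! no-config
    rewrite Σbin-middle (2 + k) m n≡κ+m | [n+κ+1]/2 (2 + k) m n≡κ+m | +-suc a b =
    square-bound n _ (2 + (lightError a + lightError b)) _ _ (5 + k) r L (size-≤ F F! no-config) ρ≤ r²≤

-- The O-term is expressed without roots: taking the square root and dividing by n^{3/2} times the
-- binomial coefficient gives the error K √(log n) / n^{3/2}. Truncated subtraction makes the claim
-- one-sided, as intended.
theorem2p14 : (s t h : ℕ) → 1 ≤ s → 1 ≤ t → 3 ≤ h →
    ∃ λ K → ∃ λ n₀ → ∀ n → n₀ ≤ n →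
    (F : List (Subset n)) → Unique F → ¬ Config n s t h F →
    let D = (n * length F) ∸ (n * Σbin n (h ∸ 1) + 2 * (s + t ∸ 2) * (n C ((n + h) / 2)))
    in D * D * n ≤ K * K * (n C ((n + h) / 2)) * (n C ((n + h) / 2)) * ⌊log₂ n ⌋
theorem2p14 (suc a) (suc b) (suc (suc (suc k))) (s≤s z≤n) (s≤s z≤n) (s≤s (s≤s (s≤s z≤n))) =
  -- The threshold adds three requirements: `2 + k` for h - 1 ≤ n, `2 * (C₀ * C₀)` for
  -- `log₂-sublinear` at `C₀`, and `6 * a + 6 * b` for `bootstrap`.
  6 * ((2 + (lightError a + lightError b)) * (5 + k)) , 2 + k + (2 * (C₀ * C₀) + (6 * a + 6 * b)) ,
  λ n n₀≤n → deviation-≤ a b k n g refl (m+n≤o⇒m≤o (2 + k) n₀≤n)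
    (m+n≤o⇒n≤o (2 * (C₀ * C₀)) (m+n≤o⇒n≤o (2 + k) n₀≤n))
    (m+n≤o⇒m≤o (2 * (C₀ * C₀)) (m+n≤o⇒n≤o (2 + k) n₀≤n))
  where
  g C₀ : ℕ
  g  = 36 * (5 + k)
  C₀ = 30 * (g * g)
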